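{- There are infinitely many natural numbers $n$ such that $\omega(n)=\omega(n+1)$, where $\omega(m)$ denotes the number of distinct prime divisors of $m$. -}

module Defs where

open import Data.Nat using (ℕ; suc)
open import Data.Nat.Primality using (Prime; prime?)
open import Data.Nat.Divisibility using (_∣_; _∣?_)
open import Data.List using (List; upTo; filter; length)
open import Data.Product using (_×_)
open import Relation.Nullary.Decidable using (_×-dec_)

-- The set of distinct prime divisors of m (for m ≥ 1), listed as the
-- primes p ∈ {0, …, m} with p ∣ m (every prime divisor of m ≥ 1 is ≤ m).
primeDivisors : ℕ → List ℕ
primeDivisors m = filter (λ p → prime? p ×-dec (p ∣? m)) (upTo (suc m))

-- ω(m): the number of distinct prime divisors of m (meaningful for m ≥ 1).
ω : ℕ → ℕ
ω m = length (primeDivisors m)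

{-# OPTIONS --safe #-}

{-
Call N₁, …, N_K a tuple if for all i < j the difference d = N_j − N_i divides both numbers, so that a = N_i / d
and a + 1 = N_j / d are consecutive, and if ω(a) − φ_i = ω(a + 1) − φ_j for potentials φ.  If Q is a common multiple
and N_i q_i = Q, then N_i + Q² s = N_i L_i with L_i = 1 + Q q_i s, and a L_i, (a + 1) L_j are consecutive with equal ω
as soon as ω(L_i) + φ_i = ω(L_j) + φ_j.

A tuple is enlarged by passing to A, A + N₁, …, A + N_n with A = Q t, where A + N_i = N_i G_i and G_i = 1 + q_i t.
This is a tuple again, with the same differences between the old elements, provided that ω(q_i) + φ_i does not
depend on i and the G_i are prime to Q.  To restore the first condition, the new Q is A ∏ G_i ∏ f_i σ with
f_i ∣ G_i and ω(f_i) = ω(σ), where σ takes care of the primes ≤ K + 1; the residue of t modulo the other primes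
dividing Q can be chosen so that the G_i are prime to Q.  In this way log Q is multiplied by a bounded power of K
in each step, so that log log Q = O(K log K).

Choosing s suitably modulo ∏ f_i with ω(f_i) = ω(q_i) makes all potentials equal.  Now let s run through an
arithmetic progression of length M, where log M is polynomial in K and the bound for log Q.  As in Turán's proof of the Hardy–Ramanujan
theorem, the mean square of ω(L_i) − ω(L_j) is O(log log M) = O(K log K).  This is less than a small
multiple of K², so the K numbers ω(L_i) cannot be distinct for all s.
-}

module Submission where

open import Defs
open import Data.Nat
open import Data.Nat.Properties
open import Data.Nat.Divisibility
open import Data.Nat.DivMod
open import Data.Nat.Primality
open import Data.Nat.Primality.Factorisation using (factorise)
open import Data.Nat.Coprimality as Cop using (Coprime; coprime-divisor; coprime-Bézout)
open import Data.Nat.GCD using (module Bézout)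
open import Data.Nat.Combinatorics using (_C_; nCk≡n!/k![n-k]!; k![n∸k]!∣n!; nCk+nC[k+1]≡[n+1]C[k+1])
open import Data.Nat.Tactic.RingSolver using (solve-∀)
open import Data.List using ([]; _∷_; length; filter; upTo; _∷ʳ_; _++_)
open import Data.Nat.ListAction using (product)
open import Data.List.Properties using (applyUpTo-∷ʳ; filter-++; length-++)
open import Data.List.Relation.Unary.All using ([]; _∷_)
open import Data.Product using (Σ; ∃; ∃-syntax; ∃₂; _×_; _,_; proj₁; proj₂)
open import Data.Sum using (_⊎_; inj₁; inj₂)
open import Data.Empty using (⊥; ⊥-elim)
open import Function using (_∘_; id; case_of_)
open import Relation.Binary.Definitions using (tri<; tri≈; tri>)
open import Relation.Nullary using (Dec; yes; no; ¬_; contradiction)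
open import Relation.Nullary.Decidable using (_×-dec_; ¬?)
open import Relation.Binary.PropositionalEquality
  using (_≡_; _≢_; refl; sym; trans; cong; cong₂; subst; module ≡-Reasoning)
open import Data.Fin using (Fin; toℕ; fromℕ<)
open import Data.Fin.Properties using (toℕ<n; toℕ-fromℕ<; pigeonhole)

private variable
  Φ Ψ : Set

-- Finite sums and products

∑ : ℕ → (ℕ → ℕ) → ℕ
∑ zero    f = 0
∑ (suc n) f = ∑ n f + f n

∏ : ℕ → (ℕ → ℕ) → ℕ
∏ zero    f = 1
∏ (suc n) f = ∏ n f * f n

∑-cong : ∀ n {f g} → (∀ i → i < n → f i ≡ g i) → ∑ n f ≡ ∑ n g
∑-cong zero    h = refl
∑-cong (suc n) h = cong₂ _+_ (∑-cong n λ i i<n → h i (m<n⇒m<1+n i<n)) (h n (n<1+n n))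

∑-mono : ∀ n {f g} → (∀ i → i < n → f i ≤ g i) → ∑ n f ≤ ∑ n g
∑-mono zero    h = z≤n
∑-mono (suc n) h = +-mono-≤ (∑-mono n λ i i<n → h i (m<n⇒m<1+n i<n)) (h n (n<1+n n))

∑-+ : ∀ n f g → ∑ n (λ i → f i + g i) ≡ ∑ n f + ∑ n g
∑-+ zero    f g = refl
∑-+ (suc n) f g rewrite ∑-+ n f g = lemma (∑ n f) (∑ n g) (f n) (g n)
  where
  lemma : ∀ a b c d → a + b + (c + d) ≡ a + c + (b + d)
  lemma = solve-∀

∑-*ˡ : ∀ n c f → ∑ n (λ i → c * f i) ≡ c * ∑ n f
∑-*ˡ zero    c f = sym (*-zeroʳ c)
∑-*ˡ (suc n) c f rewrite ∑-*ˡ n c f = sym (*-distribˡ-+ c (∑ n f) (f n))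

∑-*ʳ : ∀ n c f → ∑ n (λ i → f i * c) ≡ ∑ n f * c
∑-*ʳ n c f = trans (∑-cong n λ i _ → *-comm (f i) c) (trans (∑-*ˡ n c f) (*-comm c _))

∑-const : ∀ n c → ∑ n (λ _ → c) ≡ n * c
∑-const zero    c = refl
∑-const (suc n) c rewrite ∑-const n c = +-comm (n * c) c

∑-≤-const : ∀ n {f} c → (∀ i → i < n → f i ≤ c) → ∑ n f ≤ n * c
∑-≤-const n c h = ≤-trans (∑-mono n h) (≤-reflexive (∑-const n c))

∑-zero : ∀ n {f} → (∀ i → i < n → f i ≡ 0) → ∑ n f ≡ 0
∑-zero n h = trans (∑-cong n h) (trans (∑-const n 0) (*-zeroʳ n))

∑-swap : ∀ m n (f : ℕ → ℕ → ℕ) →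
         ∑ m (λ i → ∑ n (λ j → f i j)) ≡ ∑ n (λ j → ∑ m (λ i → f i j))
∑-swap zero    n f = sym (∑-zero n λ _ _ → refl)
∑-swap (suc m) n f =
  trans (cong (_+ ∑ n (f m)) (∑-swap m n f))
        (sym (∑-+ n (λ j → ∑ m (λ i → f i j)) (f m)))

∑-split : ∀ m n f → ∑ (m + n) f ≡ ∑ m f + ∑ n (λ i → f (m + i))
∑-split m zero    f rewrite +-identityʳ m = sym (+-identityʳ _)
∑-split m (suc n) f rewrite +-suc m n | ∑-split m n f =
  +-assoc (∑ m f) _ _

∑-monoˡ : ∀ {m n} f → m ≤ n → ∑ m f ≤ ∑ n f
∑-monoˡ {m} {n} f m≤n =
  subst (λ k → ∑ m f ≤ ∑ k f) (m+[n∸m]≡n m≤n)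
    (≤-trans (m≤m+n _ _) (≤-reflexive (sym (∑-split m (n ∸ m) f))))

term≤∑ : ∀ {n i} f → i < n → f i ≤ ∑ n f
term≤∑ {n} {i} f i<n = ≤-trans (m≤n+m (f i) (∑ i f)) (∑-monoˡ f i<n)

∑-*-∑ : ∀ m n f g → ∑ m f * ∑ n g ≡ ∑ m (λ p → ∑ n (λ q → f p * g q))
∑-*-∑ m n f g = sym (trans (∑-cong m λ p _ → ∑-*ˡ n (f p) g) (∑-*ʳ m (∑ n g) f))

∏-cong : ∀ n {f g} → (∀ i → i < n → f i ≡ g i) → ∏ n f ≡ ∏ n g
∏-cong zero    h = refl
∏-cong (suc n) h = cong₂ _*_ (∏-cong n λ i i<n → h i (m<n⇒m<1+n i<n)) (h n (n<1+n n))

∏-mono : ∀ n {f g} → (∀ i → i < n → f i ≤ g i) → ∏ n f ≤ ∏ n g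
∏-mono zero    h = ≤-refl
∏-mono (suc n) h = *-mono-≤ (∏-mono n λ i i<n → h i (m<n⇒m<1+n i<n)) (h n (n<1+n n))

∏-const : ∀ n c → ∏ n (λ _ → c) ≡ c ^ n
∏-const zero    c = refl
∏-const (suc n) c rewrite ∏-const n c = *-comm (c ^ n) c

∏-≤-const : ∀ n {f} c → (∀ i → i < n → f i ≤ c) → ∏ n f ≤ c ^ n
∏-≤-const n c h = ≤-trans (∏-mono n h) (≤-reflexive (∏-const n c))

∏>0 : ∀ n {f} → (∀ i → i < n → 0 < f i) → 0 < ∏ n f
∏>0 zero    h = z<s
∏>0 (suc n) h = *-mono-≤ (∏>0 n λ i i<n → h i (m<n⇒m<1+n i<n)) (h n (n<1+n n))

∣∏ : ∀ {n i} f → i < n → f i ∣ ∏ n f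
∣∏ {suc n} {i} f i<1+n with m<1+n⇒m<n∨m≡n i<1+n
... | inj₁ i<n  = ∣m⇒∣m*n (f n) (∣∏ f i<n)
... | inj₂ refl = n∣m*n (∏ n f)

-- Indicators of decidable propositions

χ : Dec Φ → ℕ
χ (yes _) = 1
χ (no _)  = 0

χ≤1 : (d : Dec Φ) → χ d ≤ 1
χ≤1 (yes _) = ≤-refl
χ≤1 (no _)  = z≤n

χ-yes : (d : Dec Φ) → Φ → χ d ≡ 1
χ-yes (yes _) a = refl
χ-yes (no ¬a) a = contradiction a ¬a

χ-no : (d : Dec Φ) → ¬ Φ → χ d ≡ 0
χ-no (yes a) ¬a = contradiction a ¬a
χ-no (no _)  ¬a = refl

χ-mono : (d : Dec Φ) (e : Dec Ψ) → (Φ → Ψ) → χ d ≤ χ e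
χ-mono (yes a) e f = ≤-reflexive (sym (χ-yes e (f a)))
χ-mono (no _)  e f = z≤n

χ-cong : (d : Dec Φ) (e : Dec Ψ) → (Φ → Ψ) → (Ψ → Φ) → χ d ≡ χ e
χ-cong d e f g = ≤-antisym (χ-mono d e f) (χ-mono e d g)

χ-× : (d : Dec Φ) (e : Dec Ψ) → χ (d ×-dec e) ≡ χ d * χ e
χ-× (yes a) (yes b) = refl
χ-× (yes a) (no ¬b) = refl
χ-× (no ¬a) e       = refl

χ-** : (d : Dec Φ) → χ d * χ d ≡ χ d
χ-** (yes _) = refl
χ-** (no _)  = refl

-- Congruences

infix 4 _≡_[mod_]

-- The two multipliers `u` and `v` stand in for a signed quotient, so that no subtraction occurs.
record _≡_[mod_] (x y m : ℕ) : Set where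
  constructor congruent
  field
    u v : ℕ
    eq  : x + m * u ≡ y + m * v

mod-refl : ∀ {m x} → x ≡ x [mod m ]
mod-refl = congruent 0 0 refl

mod-reflexive : ∀ {m x y} → x ≡ y → x ≡ y [mod m ]
mod-reflexive refl = mod-refl

mod-sym : ∀ {m x y} → x ≡ y [mod m ] → y ≡ x [mod m ]
mod-sym (congruent u v eq) = congruent v u (sym eq)

mod-trans : ∀ {m x y z} → x ≡ y [mod m ] → y ≡ z [mod m ] → x ≡ z [mod m ]
mod-trans {m} {x} {y} {z} (congruent u v eq) (congruent u′ v′ eq′) = congruent (u + u′) (v + v′) (begin
  x + m * (u + u′)      ≡⟨ lemma x m u u′ ⟩
  (x + m * u) + m * u′  ≡⟨ cong (_+ m * u′) eq ⟩
  (y + m * v) + m * u′  ≡⟨ lemma′ y (m * v) (m * u′) ⟩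
  (y + m * u′) + m * v  ≡⟨ cong (_+ m * v) eq′ ⟩
  (z + m * v′) + m * v  ≡⟨ lemma″ z m v′ v ⟩
  z + m * (v + v′)      ∎)
  where
  open ≡-Reasoning
  lemma : ∀ a b c d → a + b * (c + d) ≡ (a + b * c) + b * d
  lemma = solve-∀
  lemma′ : ∀ a b c → a + b + c ≡ a + c + b
  lemma′ = solve-∀
  lemma″ : ∀ a b c d → (a + b * c) + b * d ≡ a + b * (d + c)
  lemma″ = solve-∀

mod-+ : ∀ {m x y} c → x ≡ y [mod m ] → c + x ≡ c + y [mod m ]
mod-+ {m} {x} {y} c (congruent u v eq) =
  congruent u v (trans (+-assoc c x _) (trans (cong (c +_) eq) (sym (+-assoc c y _))))

mod-* : ∀ {m x y} c → x ≡ y [mod m ] → c * x ≡ c * y [mod m ]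
mod-* {m} {x} {y} c (congruent u v eq) = congruent (c * u) (c * v)
  (trans (lemma c x m u) (trans (cong (c *_) eq) (sym (lemma c y m v))))
  where
  lemma : ∀ c x m u → c * x + m * (c * u) ≡ c * (x + m * u)
  lemma = solve-∀

mod-∣ : ∀ {m n x y} → n ∣ m → x ≡ y [mod m ] → x ≡ y [mod n ]
mod-∣ {m} {n} {x} {y} (divides k refl) (congruent u v eq) =
  congruent (k * u) (k * v) (trans (cong (x +_) (lemma k n u)) (trans eq (cong (y +_) (sym (lemma k n v)))))
  where
  lemma : ∀ k n u → n * (k * u) ≡ k * n * u
  lemma = solve-∀

∣-resp-mod : ∀ {m x y} → x ≡ y [mod m ] → m ∣ x → m ∣ y
∣-resp-mod {m} {x} {y} (congruent u v eq) m∣x =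
  ∣m+n∣m⇒∣n (subst (m ∣_) (trans eq (+-comm y _)) (∣m∣n⇒∣m+n m∣x (m∣m*n u))) (m∣m*n v)

mod-+ʳ : ∀ {m} x k → x + m * k ≡ x [mod m ]
mod-+ʳ {m} x k = congruent 0 k (trans (cong (x + m * k +_) (*-zeroʳ m)) (+-identityʳ _))

mod-% : ∀ x m .{{_ : NonZero m}} → x % m ≡ x [mod m ]
mod-% x m = congruent (x / m) 0 (begin
  x % m + m * (x / m)  ≡⟨ cong (x % m +_) (*-comm m (x / m)) ⟩
  x % m + x / m * m    ≡⟨ m≡m%n+[m/n]*n x m ⟨
  x                    ≡⟨ trans (cong (x +_) (*-zeroʳ m)) (+-identityʳ x) ⟨
  x + m * 0            ∎)
  where open ≡-Reasoning

reduce-mod : ∀ x {m} → 0 < m → ∃ λ y → y < m × y ≡ x [mod m ]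
reduce-mod x {suc m} _ = x % suc m , m%n<n x (suc m) , mod-% x (suc m)

-- Coprimality

coprime-*ˡ : ∀ {a b c} → Coprime a c → Coprime b c → Coprime (a * b) c
coprime-*ˡ {a} {b} {c} a⊥c b⊥c {d} (d∣ab , d∣c) = b⊥c (coprime-divisor d⊥a d∣ab , d∣c)
  where
  d⊥a : Coprime d a
  d⊥a (e∣d , e∣a) = a⊥c (e∣a , ∣-trans e∣d d∣c)

coprime-*ʳ : ∀ {a b c} → Coprime a b → Coprime a c → Coprime a (b * c)
coprime-*ʳ a⊥b a⊥c = Cop.sym (coprime-*ˡ (Cop.sym a⊥b) (Cop.sym a⊥c))

coprime-∣ : ∀ {a b c d} → a ∣ b → c ∣ d → Coprime b d → Coprime a c
coprime-∣ a∣b c∣d b⊥d (e∣a , e∣c) = b⊥d (∣-trans e∣a a∣b , ∣-trans e∣c c∣d)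

coprime-∏ˡ : ∀ n {f c} → (∀ i → i < n → Coprime (f i) c) → Coprime (∏ n f) c
coprime-∏ˡ zero    h = Cop.1-coprimeTo _
coprime-∏ˡ (suc n) h = coprime-*ˡ (coprime-∏ˡ n λ i i<n → h i (m<n⇒m<1+n i<n)) (h n (n<1+n n))

coprime⇒*∣ : ∀ {a b c} → Coprime a b → a ∣ c → b ∣ c → a * b ∣ c
coprime⇒*∣ {a} {b} a⊥b (divides q refl) b∣qa =
  subst (a * b ∣_) (*-comm a q) (*-monoʳ-∣ a (coprime-divisor (Cop.sym a⊥b) (subst (b ∣_) (*-comm q a) b∣qa)))

∃-prime-∣ : ∀ {n} → 1 < n → ∃ λ p → Prime p × p ∣ n
∃-prime-∣ {n} 1<n with factorise n {{>-nonZero (<-trans z<s 1<n)}}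
... | record { factors = [] ; isFactorisation = eq } = contradiction eq (>⇒≢ 1<n)
... | record { factors = p ∷ ps ; isFactorisation = eq ; factorsPrime = pp ∷ _ } =
  p , pp , subst (p ∣_) (sym eq) (m∣m*n (product ps))

0<prime : ∀ {p} → Prime p → 0 < p
0<prime pp = >-nonZero⁻¹ _ {{prime⇒nonZero pp}}

1<prime : ∀ {p} → Prime p → 1 < p
1<prime pp = nonTrivial⇒n>1 _ {{prime⇒nonTrivial pp}}

prime∤1 : ∀ {p} → Prime p → ¬ p ∣ 1
prime∤1 pp p∣1 = <⇒≢ (1<prime pp) (sym (∣1⇒≡1 p∣1))

prime∤suc : ∀ {p n} → Prime p → p ∣ n → ¬ p ∣ suc n
prime∤suc {p} {n} pp p∣n p∣1+n =
  prime∤1 pp (∣m+n∣m⇒∣n (subst (p ∣_) (+-comm 1 n) p∣1+n) p∣n)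

¬common-prime⇒coprime : ∀ {m n} → 0 < m → (∀ p → Prime p → p ∣ m → ¬ p ∣ n) → Coprime m n
¬common-prime⇒coprime {m} {n} 0<m h {zero} (0∣m , _) = contradiction (0∣⇒≡0 0∣m) (>⇒≢ 0<m)
¬common-prime⇒coprime {m} {n} 0<m h {suc zero} _ = refl
¬common-prime⇒coprime {m} {n} 0<m h {suc (suc d)} (d∣m , d∣n)
  with p , pp , p∣d ← ∃-prime-∣ {suc (suc d)} (s<s z<s) =
  contradiction (∣-trans p∣d d∣n) (h p pp (∣-trans p∣d d∣m))

prime∤⇒coprime : ∀ {p n} → Prime p → ¬ p ∣ n → Coprime p n
prime∤⇒coprime pp p∤n {d} (d∣p , d∣n) with prime⇒irreducible pp d∣p
... | inj₁ d≡1  = d≡1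
... | inj₂ refl = contradiction d∣n p∤n

coprime-prime∤ : ∀ {m n p} → Coprime m n → Prime p → p ∣ m → ¬ p ∣ n
coprime-prime∤ m⊥n pp p∣m p∣n = <⇒≢ (1<prime pp) (sym (m⊥n (p∣m , p∣n)))

primes-coprime : ∀ {p q} → Prime p → Prime q → p ≢ q → Coprime p q
primes-coprime {p} {q} pp pq p≢q = prime∤⇒coprime pp p∤q
  where
  p∤q : ¬ p ∣ q
  p∤q p∣q with prime⇒irreducible pq p∣q
  ... | inj₁ refl = contradiction (1<prime pp) (<-irrefl refl)
  ... | inj₂ p≡q  = p≢q p≡q

prime∣∏ : ∀ n {f p} → Prime p → p ∣ ∏ n f → ∃ λ i → i < n × p ∣ f i
prime∣∏ zero    pp p∣1 = contradiction p∣1 (prime∤1 pp)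
prime∣∏ (suc n) {f} pp p∣ with euclidsLemma (∏ n f) (f n) pp p∣
... | inj₁ p∣∏ with i , i<n , p∣fi ← prime∣∏ n pp p∣∏ = i , m<n⇒m<1+n i<n , p∣fi
... | inj₂ p∣fn = n , n<1+n n , p∣fn

-- The Chinese remainder theorem

abstract
  mod-inverse : ∀ {a m} → Coprime a m → ∃ λ b → a * b ≡ 1 [mod m ]
  mod-inverse {a} {m} a⊥m with coprime-Bézout a⊥m
  ... | Bézout.+- x y eq = x , congruent 0 y
    (trans (cong (a * x +_) (*-zeroʳ m)) (trans (+-identityʳ _)
      (trans (*-comm a x) (trans (sym eq) (cong (1 +_) (*-comm y m))))))
  -- Here `x * a` is -1 modulo `m`; its square is 1, which makes `x * a * x` the inverse of `a`.
  ... | Bézout.-+ x y eq = x * a * x , congruent y (x * a * y) (begin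
    a * (x * a * x) + m * y          ≡⟨ lemma a x m y ⟩
    x * a * (x * a) + y * m          ≡⟨ cong (x * a * (x * a) +_) eq ⟨
    x * a * (x * a) + (1 + x * a)    ≡⟨ lemma′ (x * a) ⟩
    1 + x * a * (1 + x * a)          ≡⟨ cong (λ k → 1 + x * a * k) eq ⟩
    1 + x * a * (y * m)              ≡⟨ lemma″ (x * a) y m ⟩
    1 + m * (x * a * y)              ∎)
    where
    open ≡-Reasoning
    lemma : ∀ a x m y → a * (x * a * x) + m * y ≡ x * a * (x * a) + y * m
    lemma = solve-∀
    lemma′ : ∀ s → s * s + (1 + s) ≡ 1 + s * (1 + s)
    lemma′ = solve-∀
    lemma″ : ∀ s y m → 1 + s * (y * m) ≡ 1 + m * (s * y)
    lemma″ = solve-∀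

  -- x = r·(b b⁻¹) + s·(a a⁻¹), reduced modulo a b.
  crt₂ : ∀ {a b} → 0 < a → 0 < b → Coprime a b → ∀ r s →
         ∃ λ x → x < a * b × x ≡ r [mod a ] × x ≡ s [mod b ]
  crt₂ {a} {b} 0<a 0<b a⊥b r s
    with b′ , bb′≡1 ← mod-inverse (Cop.sym a⊥b)
       | a′ , aa′≡1 ← mod-inverse a⊥b
    with y , y< , y≡x ← reduce-mod (r * (b * b′) + s * (a * a′)) (*-mono-≤ 0<a 0<b) =
    y , y< , mod-trans (mod-∣ (m∣m*n b) y≡x) x≡r , mod-trans (mod-∣ (n∣m*n a) y≡x) x≡s
    where
    lemma : ∀ r b s a c → r * b + s * (a * c) ≡ r * b + a * (s * c)
    lemma = solve-∀
    x≡r : r * (b * b′) + s * (a * a′) ≡ r [mod a ]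
    x≡r = mod-trans (mod-reflexive (lemma r (b * b′) s a a′))
          (mod-trans (mod-+ʳ (r * (b * b′)) (s * a′))
          (mod-trans (mod-* r bb′≡1) (mod-reflexive (*-identityʳ r))))
    x≡s : r * (b * b′) + s * (a * a′) ≡ s [mod b ]
    x≡s = mod-trans (mod-reflexive (trans (+-comm (r * (b * b′)) _) (lemma s (a * a′) r b b′)))
          (mod-trans (mod-+ʳ (s * (a * a′)) (r * b′))
          (mod-trans (mod-* s aa′≡1) (mod-reflexive (*-identityʳ s))))

  crt : ∀ n (m r : ℕ → ℕ) → (∀ i → i < n → 0 < m i) →
        (∀ i j → i < j → j < n → Coprime (m i) (m j)) →
        ∃ λ x → x < ∏ n m × (∀ i → i < n → x ≡ r i [mod m i ])
  crt zero    m r 0<m ⊥m = 0 , z<s , λ _ ()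
  crt (suc n) m r 0<m ⊥m = extend (crt n m r (λ i i<n → 0<m i (m<n⇒m<1+n i<n)) (λ i j i<j j<n → ⊥m i j i<j (m<n⇒m<1+n j<n)))
    where
    ∏⊥ : Coprime (∏ n m) (m n)
    ∏⊥ = coprime-∏ˡ n λ i i<n → ⊥m i n i<n (n<1+n n)
    join : ∀ {x y} → y ≡ r n [mod m n ] → y ≡ x [mod ∏ n m ] → (∀ i → i < n → x ≡ r i [mod m i ]) →
           ∀ i → i < suc n → y ≡ r i [mod m i ]
    join y≡r y≡x x≡r i i<1+n with m<1+n⇒m<n∨m≡n i<1+n
    ... | inj₁ i<n  = mod-trans (mod-∣ (∣∏ m i<n) y≡x) (x≡r i i<n)
    ... | inj₂ refl = y≡r
    extend : (∃ λ x → x < ∏ n m × (∀ i → i < n → x ≡ r i [mod m i ])) →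
             ∃ λ x → x < ∏ (suc n) m × (∀ i → i < suc n → x ≡ r i [mod m i ])
    extend (x , _ , x≡r) =
      let y , y< , y≡x , y≡rn = crt₂ (∏>0 n λ i i<n → 0<m i (m<n⇒m<1+n i<n)) (0<m n (n<1+n n)) ∏⊥ x (r n) in
      y , y< , join y≡rn y≡x x≡r

-- The number of distinct prime divisors as a sum over primes

-- ν is an opaque copy of ω: ω applied to an open term unfolds into the
-- primality decision procedure.

pd : ℕ → ℕ → ℕ
pd p n = χ (prime? p ×-dec (p ∣? n))

pd-yes : ∀ {p n} → Prime p → p ∣ n → pd p n ≡ 1
pd-yes {p} {n} pp p∣n = χ-yes (prime? p ×-dec (p ∣? n)) (pp , p∣n)

pd-no : ∀ {p n} → ¬ p ∣ n → pd p n ≡ 0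
pd-no {p} {n} p∤n = χ-no (prime? p ×-dec (p ∣? n)) (p∤n ∘ proj₂)

pd-cong : ∀ {p m n} → (Prime p → p ∣ m → p ∣ n) → (Prime p → p ∣ n → p ∣ m) → pd p m ≡ pd p n
pd-cong {p} {m} {n} f g = χ-cong (prime? p ×-dec (p ∣? m)) (prime? p ×-dec (p ∣? n))
  (λ (pp , p∣m) → pp , f pp p∣m) (λ (pp , p∣n) → pp , g pp p∣n)

pd-* : ∀ {p m n} → Coprime m n → pd p (m * n) ≡ pd p m + pd p n
pd-* {p} {m} {n} m⊥n with prime? p
... | no ¬pp = refl
... | yes pp with p ∣? m | p ∣? n | p ∣? (m * n)
...   | yes p∣m | yes p∣n | _         = contradiction p∣n (coprime-prime∤ m⊥n pp p∣m)
...   | yes p∣m | no _    | yes _     = refl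
...   | yes p∣m | no _    | no p∤mn   = contradiction (∣m⇒∣m*n n p∣m) p∤mn
...   | no _    | yes p∣n | yes _     = refl
...   | no _    | yes p∣n | no p∤mn   = contradiction (∣n⇒∣m*n m p∣n) p∤mn
...   | no _    | no _    | no _      = refl
...   | no p∤m  | no p∤n  | yes p∣mn with euclidsLemma m n pp p∣mn
...     | inj₁ p∣m = contradiction p∣m p∤m
...     | inj₂ p∣n = contradiction p∣n p∤n

length-filter-upTo : ∀ {P : ℕ → Set} (P? : ∀ i → Dec (P i)) n →
                     length (filter P? (upTo n)) ≡ ∑ n (λ i → χ (P? i))
length-filter-upTo P? zero    = refl
length-filter-upTo P? (suc n) = begin
  length (filter P? (upTo (suc n)))                           ≡⟨ cong (length ∘ filter P?) (applyUpTo-∷ʳ id n) ⟨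
  length (filter P? (upTo n ∷ʳ n))                            ≡⟨ cong length (filter-++ P? (upTo n) (n ∷ [])) ⟩
  length (filter P? (upTo n) ++ filter P? (n ∷ []))           ≡⟨ length-++ (filter P? (upTo n)) ⟩
  length (filter P? (upTo n)) + length (filter P? (n ∷ []))   ≡⟨ cong₂ _+_ (length-filter-upTo P? n) singleton ⟩
  ∑ n (λ i → χ (P? i)) + χ (P? n)                             ∎
  where
  open ≡-Reasoning
  singleton : length (filter P? (n ∷ [])) ≡ χ (P? n)
  singleton with P? n
  ... | yes _ = refl
  ... | no _  = refl

-- Primes above `n` contribute nothing, so the cutoff `Y` is free; a common cutoff lets several
-- values of ω be compared prime by prime.
ω-∑ : ∀ {n} Y → 0 < n → n < Y → ω n ≡ ∑ Y (λ p → pd p n)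
ω-∑ {n} Y 0<n n<Y = begin
  ω n                                                  ≡⟨ length-filter-upTo (λ p → prime? p ×-dec (p ∣? n)) (suc n) ⟩
  ∑ (suc n) (λ p → pd p n)                             ≡⟨ +-identityʳ _ ⟨
  ∑ (suc n) (λ p → pd p n) + 0                         ≡⟨ cong (∑ (suc n) (λ p → pd p n) +_) (∑-zero (Y ∸ suc n) λ i _ → pd-no (∤ i)) ⟨
  ∑ (suc n) (λ p → pd p n) + ∑ (Y ∸ suc n) (λ i → pd (suc n + i) n)  ≡⟨ ∑-split (suc n) (Y ∸ suc n) _ ⟨
  ∑ (suc n + (Y ∸ suc n)) (λ p → pd p n)               ≡⟨ cong (λ k → ∑ k (λ p → pd p n)) (m+[n∸m]≡n n<Y) ⟩
  ∑ Y (λ p → pd p n)                                   ∎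
  where
  open ≡-Reasoning
  ∤ : ∀ i → ¬ (suc n + i ∣ n)
  ∤ i d = <⇒≱ (m≤m+n (suc n) i) (∣⇒≤ {{>-nonZero 0<n}} d)

abstract
  ν : ℕ → ℕ
  ν = ω

  ν≡ω : ∀ n → ν n ≡ ω n
  ν≡ω n = refl

ν-∑ : ∀ {n} Y → 0 < n → n < Y → ν n ≡ ∑ Y (λ p → pd p n)
ν-∑ {n} Y 0<n n<Y = trans (ν≡ω n) (ω-∑ Y 0<n n<Y)

ω-* : ∀ {m n} → 0 < m → 0 < n → Coprime m n → ν (m * n) ≡ ν m + ν n
ω-* {m} {n} 0<m 0<n m⊥n = begin
  ν (m * n)                                  ≡⟨ ν-∑ (suc (m * n)) (*-mono-≤ 0<m 0<n) (n<1+n _) ⟩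
  ∑ Y (λ p → pd p (m * n))                   ≡⟨ ∑-cong Y (λ p _ → pd-* m⊥n) ⟩
  ∑ Y (λ p → pd p m + pd p n)                ≡⟨ ∑-+ Y _ _ ⟩
  ∑ Y (λ p → pd p m) + ∑ Y (λ p → pd p n)    ≡⟨ cong₂ _+_ (ν-∑ Y 0<m (s≤s (m≤m*n m n {{>-nonZero 0<n}})))
                                                          (ν-∑ Y 0<n (s≤s (m≤n*m n m {{>-nonZero 0<m}}))) ⟨
  ν m + ν n                                  ∎
  where
  open ≡-Reasoning
  Y = suc (m * n)

ω-cong : ∀ {m n} → 0 < m → 0 < n → (∀ {p} → Prime p → p ∣ m → p ∣ n) → (∀ {p} → Prime p → p ∣ n → p ∣ m) →
         ν m ≡ ν n
ω-cong {m} {n} 0<m 0<n f g =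
  trans (ν-∑ Y 0<m (s≤s (m≤m+n m n))) (trans (∑-cong Y λ p _ → pd-cong f g) (sym (ν-∑ Y 0<n (s≤s (m≤n+m n m)))))
  where
  Y = suc (m + n)

ω-absorb : ∀ {m n} → 0 < m → 0 < n → n ∣ m → ν (m * n) ≡ ν m
ω-absorb {m} {n} 0<m 0<n n∣m = ω-cong (*-mono-≤ 0<m 0<n) 0<m
  (λ pp p∣mn → case euclidsLemma m n pp p∣mn of λ where
    (inj₁ p∣m) → p∣m
    (inj₂ p∣n) → ∣-trans p∣n n∣m)
  (λ _ → ∣m⇒∣m*n n)

ω-1 : ν 1 ≡ 0
ω-1 = ν≡ω 1

ω-prime : ∀ {p} → Prime p → ν p ≡ 1
ω-prime {p} pp = begin
  ν p                                      ≡⟨ ν-∑ (suc p) (0<prime pp) (n<1+n p) ⟩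
  ∑ p (λ q → pd q p) + pd p p              ≡⟨ cong₂ _+_ (∑-zero p λ q q<p → χ-no (prime? q ×-dec (q ∣? p))
                                                (λ (pq , q∣p) → coprime-prime∤ (Cop.sym (primes-coprime pp pq (>⇒≢ q<p))) pq ∣-refl q∣p))
                                              (pd-yes pp ∣-refl) ⟩
  1                                        ∎
  where open ≡-Reasoning

ω-∏ : ∀ n {f} → (∀ i → i < n → 0 < f i) → (∀ i j → i < j → j < n → Coprime (f i) (f j)) →
      ν (∏ n f) ≡ ∑ n (λ i → ν (f i))
ω-∏ zero    0<f ⊥f = ω-1
ω-∏ (suc n) {f} 0<f ⊥f =
  trans (ω-* (∏>0 n λ i i<n → 0<f i (m<n⇒m<1+n i<n)) (0<f n (n<1+n n)) (coprime-∏ˡ n λ i i<n → ⊥f i n i<n (n<1+n n)))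
        (cong (_+ ν (f n)) (ω-∏ n (λ i i<n → 0<f i (m<n⇒m<1+n i<n)) (λ i j i<j j<n → ⊥f i j i<j (m<n⇒m<1+n j<n))))

module _ (z N : ℕ) (0<N : 0 < N) where

  private
    -- The exponent makes this `z + i` if that is a prime divisor of `N`, and 1 otherwise. With `z`
    -- = 0 and all `i ≤ N` the product is the radical of `N`.
    factor : ℕ → ℕ
    factor i = (z + i) ^ pd (z + i) N

    factor-cases : ∀ i → (Prime (z + i) × z + i ∣ N × factor i ≡ z + i) ⊎ factor i ≡ 1
    factor-cases i with prime? (z + i) | (z + i) ∣? N
    ... | yes pp | yes d = inj₁ (pp , d , *-identityʳ (z + i))
    ... | yes pp | no _  = inj₂ refl
    ... | no _   | _     = inj₂ refl

    coprime-factor : ∀ i {p} → Prime p → z + i < p → Coprime (factor i) p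
    coprime-factor i pp i<p with factor-cases i
    ... | inj₁ (pi , _ , eq) rewrite eq = primes-coprime pi pp (<⇒≢ i<p)
    ... | inj₂ eq rewrite eq = Cop.1-coprimeTo _

  factors-coprime : ∀ i j → i < j → Coprime (factor i) (factor j)
  factors-coprime i j i<j with factor-cases j
  ... | inj₁ (pj , _ , eq) rewrite eq = coprime-factor i pj (+-monoʳ-< z i<j)
  ... | inj₂ eq rewrite eq = Cop.sym (Cop.1-coprimeTo _)

  ∏-prime-divisors∣ : ∀ n → ∏ n factor ∣ N
  ∏-prime-divisors∣ zero    = 1∣ N
  ∏-prime-divisors∣ (suc n) =
    coprime⇒*∣ (coprime-∏ˡ n λ i i<n → factors-coprime i n i<n) (∏-prime-divisors∣ n) factor∣
    where
    factor∣ : factor n ∣ N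
    factor∣ with factor-cases n
    ... | inj₁ (_ , d , eq) rewrite eq = d
    ... | inj₂ eq rewrite eq = 1∣ N

  -- Distinct primes dividing `N` have a product dividing `N`, and each of them is at least `z`.
  -- This inequality bounds ω by a logarithm, yields Chebyshev's estimate, and limits the number of
  -- large prime factors.
  ^-prime-divisors≤ : .{{NonZero z}} → ∀ n → z ^ ∑ n (λ i → pd (z + i) N) ≤ N
  ^-prime-divisors≤ n = ≤-trans (go n) (∣⇒≤ {{>-nonZero 0<N}} (∏-prime-divisors∣ n))
    where
    go : ∀ n → z ^ ∑ n (λ i → pd (z + i) N) ≤ ∏ n factor
    go zero    = ≤-refl
    go (suc n) rewrite ^-distribˡ-+-* z (∑ n (λ i → pd (z + i) N)) (pd (z + n) N) =
      *-mono-≤ (go n) (^-monoˡ-≤ (pd (z + n) N) (m≤m+n z n))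

2^ω≤ : ∀ {n} → 0 < n → 2 ^ ν n ≤ n
2^ω≤ {n} 0<n = ≤-trans (≤-reflexive (cong (2 ^_) eq)) (^-prime-divisors≤ 2 n 0<n n)
  where
  eq : ν n ≡ ∑ n (λ i → pd (2 + i) n)
  -- The indices 0 and 1 are rejected by `prime?` by computation, so the part split off reduces to
  -- 0.
  eq = trans (ν-∑ (2 + n) 0<n (m≤n+m (suc n) 1)) (∑-split 2 n (λ p → pd p n))

-- The shift t

∣∸ : ∀ {d m n} → m ≤ n → d ∣ m → d ∣ n → d ∣ n ∸ m
∣∸ {d} {m} {n} m≤n d∣m d∣n = ∣m+n∣m⇒∣n (subst (d ∣_) (sym (m+[n∸m]≡n m≤n)) d∣n) d∣m

∣suc*⇒∤ˡ : ∀ {p a b} → Prime p → p ∣ suc (a * b) → ¬ p ∣ a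
∣suc*⇒∤ˡ {b = b} pp p∣ p∣a = prime∤suc pp (∣m⇒∣m*n b p∣a) p∣

<⇒prime∤ : ∀ {p n} → 0 < n → n < p → ¬ p ∣ n
<⇒prime∤ 0<n n<p p∣n = <⇒≱ n<p (∣⇒≤ {{>-nonZero 0<n}} p∣n)

-- Subtracting the two multiples of `p` leaves `a * (s ∸ r)`. A prime dividing a number that is 1
-- modulo `a` cannot divide `a`, and `s ∸ r` is positive and below `p`.
at-most-one-root : ∀ {p a r s} → Prime p → r < s → s < p → p ∣ suc (a * suc r) → ¬ p ∣ suc (a * suc s)
at-most-one-root {p} {a} {r} {s} pp r<s s<p p∣r p∣s
  with euclidsLemma a (s ∸ r) pp (subst (p ∣_) eq (∣∸ (s≤s (*-monoʳ-≤ a (s≤s (<⇒≤ r<s)))) p∣r p∣s))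
  where
  eq : suc (a * suc s) ∸ suc (a * suc r) ≡ a * (s ∸ r)
  eq = sym (*-distribˡ-∸ a (suc s) (suc r))
... | inj₁ p∣a   = ∣suc*⇒∤ˡ {b = suc r} pp p∣r p∣a
... | inj₂ p∣s∸r = <⇒prime∤ (m<n⇒0<n∸m r<s) (≤-<-trans (m∸n≤m s r) s<p) p∣s∸r

-- If no residue 1, …, n + 1 is admissible, two of them are excluded by the same index i.
avoiding-residue : ∀ {p} n (q : ℕ → ℕ) → Prime p → (p ≤ suc n → ∀ i → i < n → p ∣ q i) →
                   ∃ λ r → ¬ p ∣ r × (∀ i → i < n → ¬ p ∣ suc (q i * r))
avoiding-residue {p} n q pp small with p ≤? suc n
-- A small prime leaves too few residues for the counting argument, but it divides every `q i`, so
-- all these numbers are 1 modulo `p`.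
... | yes p≤1+n = 1 , prime∤1 pp , λ i i<n → prime∤suc pp (∣m⇒∣m*n 1 (small p≤1+n i i<n))
... | no p≰1+n
  with anyUpTo? (λ r → allUpTo? (λ i → ¬? (p ∣? suc (q i * suc r))) n) (suc n)
...   | yes (r , r<1+n , good) =
  suc r , <⇒prime∤ z<s (≤-<-trans r<1+n (≰⇒> p≰1+n)) , λ i i<n → good i<n
...   | no none = ⊥-elim impossible
  where
  culprit : ∀ r → r < suc n → ∃ λ i → i < n × p ∣ suc (q i * suc r)
  culprit r r<1+n with anyUpTo? (λ i → p ∣? suc (q i * suc r)) n
  ... | yes found = found
  ... | no ∄ = contradiction (r , r<1+n , λ {i} i<n d → ∄ (i , i<n , d)) none
  index : Fin (suc n) → Fin n
  index r = fromℕ< (proj₁ (proj₂ (culprit (toℕ r) (toℕ<n r))))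
  impossible : ⊥
  impossible with pigeonhole (n<1+n n) index
  ... | r , s , r<s , eq
    with culprit (toℕ r) (toℕ<n r) | culprit (toℕ s) (toℕ<n s)
  ...   | i , i<n , p∣r | j , j<n , p∣s =
    at-most-one-root {a = q j} pp r<s (<-trans (toℕ<n s) (≰⇒> p≰1+n))
      (subst (λ k → p ∣ suc (q k * suc (toℕ r))) i≡j p∣r) p∣s
    where
    i≡j : i ≡ j
    i≡j = trans (sym (toℕ-fromℕ< i<n)) (trans (cong toℕ eq) (toℕ-fromℕ< j<n))

-- Prime factors of the pairwise coprime numbers 1 + j Q J!, where 1 ≤ j ≤ J.
module _ (Q J : ℕ) (0<Q : 0 < Q) where

  private
    gödel : ℕ → ℕ
    gödel j = suc (suc j * (Q * J !))

    1<gödel : ∀ j → 1 < gödel j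
    1<gödel j = s≤s (*-mono-≤ {1} {suc j} (s≤s z≤n) (*-mono-≤ 0<Q (1≤n! J)))

  freshPrime : ℕ → ℕ
  freshPrime j = proj₁ (∃-prime-∣ (1<gödel j))

  freshPrime-prime : ∀ j → Prime (freshPrime j)
  freshPrime-prime j = proj₁ (proj₂ (∃-prime-∣ (1<gödel j)))

  private
    freshPrime-∣ : ∀ j → freshPrime j ∣ gödel j
    freshPrime-∣ j = proj₂ (proj₂ (∃-prime-∣ (1<gödel j)))

    freshPrime-∤Q*J! : ∀ j → ¬ freshPrime j ∣ Q * J !
    freshPrime-∤Q*J! j p∣ = prime∤suc (freshPrime-prime j) (∣n⇒∣m*n (suc j) p∣) (freshPrime-∣ j)

  freshPrime-∤ : ∀ j → ¬ freshPrime j ∣ Q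
  freshPrime-∤ j p∣Q = freshPrime-∤Q*J! j (∣m⇒∣m*n (J !) p∣Q)

  freshPrime-≤ : ∀ j → j < J → freshPrime j ≤ suc (J * (Q * J !))
  freshPrime-≤ j j<J = ≤-trans (∣⇒≤ (freshPrime-∣ j)) (s≤s (*-monoˡ-≤ (Q * J !) j<J))

  -- The two numbers `gödel i` and `gödel j` differ by `(j ∸ i) * (Q * J !)`, and `j ∸ i` divides
  -- `J !`; a common prime would therefore divide `Q * J !`, to which both are coprime.
  freshPrime-≢ : ∀ i j → i < j → j < J → freshPrime i ≢ freshPrime j
  freshPrime-≢ i j i<j j<J eq
    with euclidsLemma (j ∸ i) (Q * J !) pp (subst (freshPrime i ∣_) difference
           (∣∸ (s≤s (*-monoˡ-≤ (Q * J !) (s≤s (<⇒≤ i<j)))) (freshPrime-∣ i) (subst (_∣ gödel j) (sym eq) (freshPrime-∣ j))))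
    where
    pp = freshPrime-prime i
    difference : gödel j ∸ gödel i ≡ (j ∸ i) * (Q * J !)
    difference = sym (*-distribʳ-∸ (Q * J !) (suc j) (suc i))
  ... | inj₂ p∣ = freshPrime-∤Q*J! i p∣
  ... | inj₁ p∣j∸i = freshPrime-∤Q*J! i (∣n⇒∣m*n Q (∣-trans p∣j∸i (∣-trans (m∣m! (m<n⇒0<n∸m i<j))
                       (m≤n⇒m!∣n! (≤-trans (m∸n≤m j i) (<⇒≤ j<J))))))
    where
    m∣m! : ∀ {m} → 0 < m → m ∣ m !
    m∣m! {suc m} _ = m∣m*n (m !)

root-mod : ∀ {a m} → 0 < m → Coprime a m → ∃ λ x → ∀ y → y ≡ x [mod m ] → m ∣ suc (a * y)
root-mod {a} {suc m} 0<m a⊥m with b , ab≡1 ← mod-inverse a⊥m =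
  -- Modulo `suc m` the factor `m` is -1, so `b * m` is the root -1/a.
  b * m , λ y y≡x → ∣-resp-mod (mod-sym (mod-trans (mod-+ 1 (mod-* a y≡x))
    (mod-trans (mod-reflexive (cong suc (trans (sym (*-assoc a b m)) (*-comm (a * b) m))))
    (mod-trans (mod-+ 1 (mod-* m ab≡1)) (mod-reflexive (cong suc (*-identityʳ m))))))) ∣-refl

block-index : ∀ {n w i l} → i < n → l < w → i * w + l < n * w
block-index {n} {w} {i} {l} i<n l<w =
  <-≤-trans (+-monoʳ-< (i * w) l<w) (≤-trans (≤-reflexive (+-comm (i * w) w)) (*-monoˡ-≤ w i<n))

-- Two systems of congruences are joined: an avoiding residue modulo each prime divisor of `Q`, and
-- a root modulo each `f i`, a product of fresh primes. Fresh primes do not divide `Q`, so the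
-- moduli are coprime and `t` is below their product. The `w i` may vary because the shift serves
-- twice: for enlarging a tuple and for equalising its potentials.
shift : ∀ Q n (q w : ℕ → ℕ) W → 1 < Q → (∀ i → i < n → q i ∣ Q) →
        (∀ p → Prime p → p ≤ suc n → ∀ i → i < n → p ∣ q i) → (∀ i → i < n → w i ≤ W) →
        let J = n * W; F = suc (J * (Q * J !)) in
        ∃₂ λ t f → 0 < t × Coprime t Q × t ≤ Q * (F ^ W) ^ n ×
        (∀ i → i < n → Coprime (suc (q i * t)) Q × f i ∣ suc (q i * t) × ν (f i) ≡ w i × 0 < f i × f i ≤ F ^ W)
shift Q n q w W 1<Q q∣Q small w≤W = t , f , 0<t , t⊥Q , t≤ , λ i i<n →
  G⊥Q i i<n , proj₂ (root i i<n) t (mod-trans (mod-∣ (∣∏ f i<n) t≡f) (t₂≡ i i<n)) , ω-f i i<n , 0<f i , f≤ i i<n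
  where
  J = n * W
  F = suc (J * (Q * J !))
  0<Q = <-trans z<s 1<Q
  P = freshPrime Q J 0<Q
  pP = freshPrime-prime Q J 0<Q
  -- The fresh primes are arranged in `n` blocks of length `W`; `f i` takes the first `w i` primes
  -- of block `i`.
  f : ℕ → ℕ
  f i = ∏ (w i) (λ l → P (i * W + l))
  0<f : ∀ i → 0 < f i
  0<f i = ∏>0 (w i) λ l _ → 0<prime (pP (i * W + l))
  P⊥P : ∀ i j → i < j → j < J → Coprime (P i) (P j)
  P⊥P i j i<j j<J = primes-coprime (pP i) (pP j) (freshPrime-≢ Q J 0<Q i j i<j j<J)
  f≤ : ∀ i → i < n → f i ≤ F ^ W
  f≤ i i<n = ≤-trans (∏-≤-const (w i) F λ l l<w → freshPrime-≤ Q J 0<Q _ (block-index i<n (<-≤-trans l<w (w≤W i i<n))))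
                     (^-monoʳ-≤ F (w≤W i i<n))
  ω-f : ∀ i → i < n → ν (f i) ≡ w i
  ω-f i i<n = trans (ω-∏ (w i) (λ l _ → 0<prime (pP (i * W + l)))
                      (λ l l′ l<l′ l′<w → P⊥P _ _ (+-monoʳ-< (i * W) l<l′) (block-index i<n (<-≤-trans l′<w (w≤W i i<n)))))
                    (trans (∑-cong (w i) λ l _ → ω-prime (pP (i * W + l))) (trans (∑-const (w i) 1) (*-identityʳ (w i))))
  f⊥f : ∀ i j → i < j → j < n → Coprime (f i) (f j)
  f⊥f i j i<j j<n = coprime-∏ˡ (w i) λ l l<w → Cop.sym (coprime-∏ˡ (w j) λ l′ l′<w →
    Cop.sym (P⊥P _ _ (<-≤-trans (block-index i<j (<-≤-trans l<w (w≤W i (<-trans i<j j<n)))) (m≤m+n (j * W) l′))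
                 (block-index j<n (<-≤-trans l′<w (w≤W j j<n)))))
  Q⊥f : ∀ i → Coprime Q (f i)
  Q⊥f i = Cop.sym (coprime-∏ˡ (w i) λ l _ → prime∤⇒coprime (pP (i * W + l)) (freshPrime-∤ Q J 0<Q (i * W + l)))
  root : ∀ i → i < n → ∃ λ x → ∀ y → y ≡ x [mod f i ] → f i ∣ suc (q i * y)
  root i i<n = root-mod (0<f i) (coprime-∣ (q∣Q i i<n) ∣-refl (Q⊥f i))
  x₂ : ℕ → ℕ
  x₂ i with i <? n
  ... | yes i<n = proj₁ (root i i<n)
  ... | no _    = 0
  x₂-root : ∀ i (i<n : i < n) → x₂ i ≡ proj₁ (root i i<n)
  x₂-root i i<n with i <? n
  ... | yes i<n′ rewrite <-irrelevant i<n′ i<n = refl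
  ... | no i≮n   = contradiction i<n i≮n
  crt-f = crt n f x₂ (λ i _ → 0<f i) f⊥f
  t₂ = proj₁ crt-f
  t₂≡ : ∀ i (i<n : i < n) → t₂ ≡ proj₁ (root i i<n) [mod f i ]
  t₂≡ i i<n = mod-trans (proj₂ (proj₂ crt-f) i i<n) (mod-reflexive (x₂-root i i<n))
  -- The modulus is `p` for a prime divisor `p` of `Q` and 1 otherwise. Hence the product divides
  -- `Q`, and the default residue 0 that `x₁` has at non-primes imposes no condition.
  m : ℕ → ℕ
  m p = p ^ pd p Q
  x₁ : ℕ → ℕ
  x₁ p with prime? p
  ... | yes pp = proj₁ (avoiding-residue n q pp (small p pp))
  ... | no _   = 0
  x₁-avoids : ∀ p → Prime p → ¬ p ∣ x₁ p × (∀ i → i < n → ¬ p ∣ suc (q i * x₁ p))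
  x₁-avoids p pp with prime? p
  ... | yes pp′ = proj₂ (avoiding-residue n q pp′ (small p pp′))
  ... | no ¬pp  = contradiction pp ¬pp
  0<m : ∀ p → 0 < m p
  0<m p with prime? p | p ∣? Q
  ... | yes pp | yes _ = subst (0 <_) (sym (*-identityʳ p)) (0<prime pp)
  ... | yes pp | no _  = z<s
  ... | no _   | _     = z<s
  crt-Q = crt (suc Q) m x₁ (λ p _ → 0<m p) (λ p r p<r _ → factors-coprime 0 Q 0<Q p r p<r)
  t₁ = proj₁ crt-Q
  ∏m∣Q : ∏ (suc Q) m ∣ Q
  ∏m∣Q = ∏-prime-divisors∣ 0 Q 0<Q (suc Q)
  crt-t = crt₂ (∏>0 (suc Q) (λ p _ → 0<m p)) (∏>0 n (λ i _ → 0<f i))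
               (coprime-∣ ∏m∣Q ∣-refl (Cop.sym (coprime-∏ˡ n λ i _ → Cop.sym (Q⊥f i)))) t₁ t₂
  t = proj₁ crt-t
  t≡f = proj₂ (proj₂ (proj₂ crt-t))
  t≡x₁ : ∀ p → Prime p → p ∣ Q → t ≡ x₁ p [mod p ]
  t≡x₁ p pp p∣Q = mod-trans (mod-∣ (subst (_∣ _) m≡p (∣∏ m p<1+Q)) (proj₁ (proj₂ (proj₂ crt-t))))
                            (mod-∣ (subst (p ∣_) (sym m≡p) ∣-refl) (proj₂ (proj₂ crt-Q) p p<1+Q))
    where
    p<1+Q = s≤s (∣⇒≤ {{>-nonZero 0<Q}} p∣Q)
    m≡p : m p ≡ p
    m≡p = trans (cong (p ^_) (pd-yes pp p∣Q)) (*-identityʳ p)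
  t⊥Q : Coprime t Q
  t⊥Q = Cop.sym (¬common-prime⇒coprime 0<Q λ p pp p∣Q p∣t →
    proj₁ (x₁-avoids p pp) (∣-resp-mod (t≡x₁ p pp p∣Q) p∣t))
  G⊥Q : ∀ i → i < n → Coprime (suc (q i * t)) Q
  G⊥Q i i<n = Cop.sym (¬common-prime⇒coprime 0<Q λ p pp p∣Q p∣G →
    proj₂ (x₁-avoids p pp) i i<n (∣-resp-mod (mod-+ 1 (mod-* (q i) (t≡x₁ p pp p∣Q))) p∣G))
  0<t : 0 < t
  0<t = n≢0⇒n>0 λ t≡0 → <⇒≢ 1<Q (sym (Cop.0-coprimeTo-m⇒m≡1 (subst (λ k → Coprime k Q) t≡0 t⊥Q)))
  t≤ : t ≤ Q * (F ^ W) ^ n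
  t≤ = ≤-trans (<⇒≤ (proj₁ (proj₂ crt-t)))
         (*-mono-≤ (∣⇒≤ {{>-nonZero 0<Q}} ∏m∣Q) (∏-≤-const n (F ^ W) f≤))

-- Tuples

-- `ω-q` is the condition under which a number `Q * t` can be put in front of the shifted elements
-- `N i + Q * t`: the difference is `N i`, and the quotient is `q i * t`. `σ∣q` passes the prime
-- divisors of `σ`, later all primes up to K + 1, on to the `q i`, as `shift` demands.
record Tuple (σ n : ℕ) : Set where
  field
    N q φ : ℕ → ℕ
    Q ψ   : ℕ
    1<Q   : 1 < Q
    σ∣Q   : σ ∣ Q
    N*q   : ∀ i → i < n → N i * q i ≡ Q
    σ∣q   : ∀ i → i < n → σ ∣ q i
    ω-q   : ∀ i → i < n → ν (q i) + φ i ≡ ψ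
    pair  : ∀ i j → i < j → j < n →
            ∃₂ λ d a → N i ≡ a * d × N j ≡ suc a * d × ν a + φ j ≡ ν (suc a) + φ i

  0<Q : 0 < Q
  0<Q = <-trans z<s 1<Q

  N∣Q : ∀ i → i < n → N i ∣ Q
  N∣Q i i<n = subst (N i ∣_) (N*q i i<n) (m∣m*n (q i))

  q∣Q : ∀ i → i < n → q i ∣ Q
  q∣Q i i<n = subst (q i ∣_) (N*q i i<n) (n∣m*n (N i))

∣⇒0< : ∀ {m n} → m ∣ n → 0 < n → 0 < m
∣⇒0< {zero}  0∣n 0<n = contradiction (0∣⇒≡0 0∣n) (>⇒≢ 0<n)
∣⇒0< {suc m} _   _   = z<s

module _ {N₁ N₂ a d b₁ b₂ : ℕ} (0<d : 0 < d) (N₁≡ : N₁ ≡ a * d) (N₂≡ : N₂ ≡ suc a * d)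
         (eq : N₁ * b₁ ≡ N₂ * b₂) where

  -- Adding the common value `N₁ * b₁ ≡ N₂ * b₂` to both numbers preserves their difference `d`, so
  -- after division by `d` they are consecutive again.
  consecutive : suc (a * suc b₁) ≡ suc a * suc b₂
  consecutive = *-cancelʳ-≡ _ _ d {{>-nonZero 0<d}} (begin
    suc (a * suc b₁) * d          ≡⟨ lemma a d b₁ ⟩
    suc a * d + a * d * b₁        ≡⟨ cong (λ k → suc a * d + k * b₁) N₁≡ ⟨
    suc a * d + N₁ * b₁           ≡⟨ cong (suc a * d +_) eq ⟩
    suc a * d + N₂ * b₂           ≡⟨ cong (λ k → suc a * d + k * b₂) N₂≡ ⟩
    suc a * d + suc a * d * b₂    ≡⟨ lemma′ (suc a) d b₂ ⟩
    suc a * suc b₂ * d            ∎)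
    where
    open ≡-Reasoning
    lemma : ∀ a d b → suc (a * suc b) * d ≡ suc a * d + a * d * b
    lemma = solve-∀
    lemma′ : ∀ a d b → a * d + a * d * b ≡ a * suc b * d
    lemma′ = solve-∀

  -- The two numbers divide the consecutive integers `a * suc b₁` and `suc a * suc b₂`.
  consecutive-coprime : Coprime (suc b₁) (suc b₂)
  consecutive-coprime {e} (e∣₁ , e∣₂) =
    ∣1⇒≡1 (∣m+n∣m⇒∣n (subst (e ∣_) (trans (sym consecutive) (+-comm 1 _)) (∣n⇒∣m*n (suc a) e∣₂)) (∣n⇒∣m*n a e∣₁))

-- The product of `except f i` is the product of `f` without its factor at `i`, obtained without
-- division.
except : (ℕ → ℕ) → ℕ → ℕ → ℕ
except f i j = f j ^ χ (¬? (j ≟ i))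

except-≡ : ∀ f i → except f i i ≡ 1
except-≡ f i = cong (f i ^_) (χ-no (¬? (i ≟ i)) (λ i≢i → i≢i refl))

except-≢ : ∀ f {i j} → j ≢ i → except f i j ≡ f j
except-≢ f {i} {j} j≢i = trans (cong (f j ^_) (χ-yes (¬? (j ≟ i)) j≢i)) (*-identityʳ (f j))

∏-except : ∀ n {i} f → i < n → ∏ n f ≡ ∏ n (except f i) * f i
∏-except (suc n) {i} f i<1+n with m<1+n⇒m<n∨m≡n i<1+n
... | inj₂ refl = cong (_* f n) (sym (trans (cong₂ _*_ (∏-cong n λ j j<n → except-≢ f (<⇒≢ j<n)) (except-≡ f n)) (*-identityʳ (∏ n f))))
... | inj₁ i<n rewrite ∏-except n f i<n | except-≢ f (>⇒≢ i<n) = swap (∏ n (except f i)) (f i) (f n)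
  where
  swap : ∀ a b c → a * b * c ≡ a * c * b
  swap = solve-∀

except-coprime : ∀ n {f i c} → (∀ j → j < n → j ≢ i → Coprime (f j) c) → Coprime (∏ n (except f i)) c
except-coprime n {f} {i} {c} h = coprime-∏ˡ n go
  where
  go : ∀ j → j < n → Coprime (except f i j) c
  go j j<n with j ≟ i
  ... | yes _  = Cop.1-coprimeTo c
  ... | no j≢i = subst (λ k → Coprime k c) (sym (*-identityʳ (f j))) (h j j<n j≢i)

-- Enlarging a tuple by a new first element

module Step {σ n : ℕ} (T : Tuple σ n) (t : ℕ) (f : ℕ → ℕ)
            (0<t : 0 < t) (t⊥Q : Coprime t (Tuple.Q T))
            (G⊥Q : ∀ i → i < n → Coprime (suc (Tuple.q T i * t)) (Tuple.Q T))
            (f∣G : ∀ i → i < n → f i ∣ suc (Tuple.q T i * t))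
            (ω-f : ∀ i → i < n → ν (f i) ≡ ν σ) where

  open Tuple T

  G H rest : ℕ → ℕ
  G i = suc (q i * t)
  H i = G i * f i
  rest i = ∏ n (except H i)

  P Γ : ℕ
  P = ∏ n H
  Γ = ∑ n (λ i → ν (G i))

  private
    0<f : ∀ i → i < n → 0 < f i
    0<f i i<n = ∣⇒0< (f∣G i i<n) z<s

    0<H : ∀ i → i < n → 0 < H i
    0<H i i<n = *-mono-≤ {1} {G i} z<s (0<f i i<n)

    0<P : 0 < P
    0<P = ∏>0 n 0<H

    0<σ : 0 < σ
    0<σ = ∣⇒0< σ∣Q 0<Q

    0<N : ∀ i → i < n → 0 < N i
    0<N i i<n = ∣⇒0< (N∣Q i i<n) 0<Q

    0<q : ∀ i → i < n → 0 < q i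
    0<q i i<n = ∣⇒0< (q∣Q i i<n) 0<Q

    G⊥t : ∀ i → Coprime (G i) t
    G⊥t i {e} (e∣G , e∣t) = ∣1⇒≡1 (∣m+n∣m⇒∣n (subst (e ∣_) (+-comm 1 (q i * t)) e∣G) (∣n⇒∣m*n (q i) e∣t))

    Nqt : ∀ i j → i < n → j < n → N i * (q i * t) ≡ N j * (q j * t)
    Nqt i j i<n j<n = trans (sym (*-assoc (N i) (q i) t))
      (trans (cong (_* t) (trans (N*q i i<n) (sym (N*q j j<n)))) (*-assoc (N j) (q j) t))

    0<d : ∀ {j a d} → j < n → N j ≡ suc a * d → 0 < d
    0<d {j} {a} {d} j<n eq = ∣⇒0< (subst (d ∣_) (sym eq) (n∣m*n (suc a))) (0<N j j<n)

    G⊥G : ∀ i j → i < j → j < n → Coprime (G i) (G j)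
    G⊥G i j i<j j<n =
      let d , a , Ni≡ , Nj≡ , _ = pair i j i<j j<n in
      consecutive-coprime {a = a} {d = d} (0<d {a = a} j<n Nj≡) Ni≡ Nj≡ (Nqt i j (<-trans i<j j<n) j<n)

    -- Consequently everything coprime to `G i` is coprime to `H i`.
    H∣GG : ∀ i → i < n → H i ∣ G i * G i
    H∣GG i i<n = *-monoʳ-∣ (G i) (f∣G i i<n)

    H⊥ : ∀ i {c} → i < n → Coprime (G i) c → Coprime (H i) c
    H⊥ i i<n G⊥c = coprime-∣ (H∣GG i i<n) ∣-refl (coprime-*ˡ G⊥c G⊥c)

    H⊥H : ∀ i j → i < j → j < n → Coprime (H i) (H j)
    H⊥H i j i<j j<n = H⊥ i (<-trans i<j j<n) (Cop.sym (H⊥ j j<n (Cop.sym (G⊥G i j i<j j<n))))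

    rest⊥ : ∀ i → i < n → Coprime (rest i) (H i)
    rest⊥ i i<n = except-coprime n λ j j<n j≢i → case <-cmp j i of λ where
      (tri< j<i _ _) → H⊥H j i j<i i<n
      (tri≈ _ j≡i _) → contradiction j≡i j≢i
      (tri> _ _ i<j) → Cop.sym (H⊥H i j i<j j<n)

    0<rest : ∀ i → i < n → 0 < rest i
    0<rest i i<n = ∣⇒0< (subst (rest i ∣_) (sym (∏-except n H i<n)) (m∣m*n (H i))) 0<P

    H⊥Qt : ∀ i → i < n → Coprime (H i) (Q * t)
    H⊥Qt i i<n = H⊥ i i<n (coprime-*ʳ (G⊥Q i i<n) (G⊥t i))

    P⊥Qt : Coprime P (Q * t)
    P⊥Qt = coprime-∏ˡ n H⊥Qt

    ω-H : ∀ i → i < n → ν (H i) ≡ ν (G i)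
    ω-H i i<n = ω-absorb {G i} z<s (0<f i i<n) (f∣G i i<n)

    ω-P : ν P ≡ Γ
    ω-P = trans (ω-∏ n 0<H H⊥H) (∑-cong n ω-H)

    ω-rest : ∀ i → i < n → ν (rest i) + ν (G i) ≡ Γ
    ω-rest i i<n = begin
      ν (rest i) + ν (G i)  ≡⟨ cong (ν (rest i) +_) (ω-H i i<n) ⟨
      ν (rest i) + ν (H i)  ≡⟨ ω-* (0<rest i i<n) (0<H i i<n) (rest⊥ i i<n) ⟨
      ν (rest i * H i)      ≡⟨ cong ν (∏-except n H i<n) ⟨
      ν P                   ≡⟨ ω-P ⟩
      Γ                     ∎
      where open ≡-Reasoning

    ω-qt : ∀ i → i < n → ν (q i * t) ≡ ν (q i) + ν t
    ω-qt i i<n = ω-* (0<q i i<n) 0<t (coprime-∣ (q∣Q i i<n) ∣-refl (Cop.sym t⊥Q))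

  -- The old elements become `N i + Q * t`, which is `N i * G i`, and the `q′` are read off from
  -- `Q′`. The factor `σ` brings `ν σ` new primes to `q′ zero` but none to `q′ (suc i)`, since it
  -- divides `q i` already. The factor `f i` of `H i`, which survives division by `G i`, makes up
  -- for exactly this amount.
  N′ q′ φ′ : ℕ → ℕ
  N′ zero    = Q * t
  N′ (suc i) = N i * G i
  q′ zero    = P * σ
  q′ (suc i) = q i * t * σ * rest i * f i
  φ′ zero    = ψ + ν t
  φ′ (suc i) = φ i + ν (G i)

  Q′ ψ′ : ℕ
  Q′ = Q * t * (P * σ)
  ψ′ = Γ + ν σ + (ψ + ν t)

  private
    N*q′ : ∀ i → i < suc n → N′ i * q′ i ≡ Q′
    N*q′ zero    _         = refl
    N*q′ (suc i) (s≤s i<n) = begin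
      N i * G i * (q i * t * σ * rest i * f i)     ≡⟨ lemma (N i) (G i) (q i) t σ (rest i) (f i) ⟩
      N i * q i * t * (rest i * (G i * f i) * σ)   ≡⟨ cong₂ (λ x y → x * t * (y * σ)) (N*q i i<n) (sym (∏-except n H i<n)) ⟩
      Q * t * (P * σ)                              ∎
      where
      open ≡-Reasoning
      lemma : ∀ N G q t σ r f → N * G * (q * t * σ * r * f) ≡ N * q * t * (r * (G * f) * σ)
      lemma = solve-∀

    σ∣q′ : ∀ i → i < suc n → σ ∣ q′ i
    σ∣q′ zero    _ = n∣m*n P
    σ∣q′ (suc i) _ = ∣m⇒∣m*n (f i) (∣m⇒∣m*n (rest i) (n∣m*n (q i * t)))

    ω-q′ : ∀ i → i < suc n → ν (q′ i) + φ′ i ≡ ψ′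
    ω-q′ zero    _         =
      cong (_+ (ψ + ν t)) (trans (ω-* 0<P 0<σ (coprime-∣ ∣-refl (∣m⇒∣m*n t σ∣Q) P⊥Qt)) (cong (_+ ν σ) ω-P))
    ω-q′ (suc i) (s≤s i<n) = begin
      ν (q i * t * σ * rest i * f i) + (φ i + ν (G i))
        ≡⟨ cong (_+ (φ i + ν (G i))) (ω-* (*-mono-≤ 0<qtσ (0<rest i i<n)) (0<f i i<n) qtσr⊥f) ⟩
      ν (q i * t * σ * rest i) + ν (f i) + (φ i + ν (G i))
        ≡⟨ cong (λ k → k + ν (f i) + (φ i + ν (G i))) (ω-* 0<qtσ (0<rest i i<n) qtσ⊥r) ⟩
      ν (q i * t * σ) + ν (rest i) + ν (f i) + (φ i + ν (G i))
        ≡⟨ cong₂ (λ x y → x + ν (rest i) + y + (φ i + ν (G i)))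
                 (trans (ω-absorb 0<qt 0<σ (∣m⇒∣m*n t (σ∣q i i<n))) (ω-qt i i<n)) (ω-f i i<n) ⟩
      ν (q i) + ν t + ν (rest i) + ν σ + (φ i + ν (G i))
        ≡⟨ lemma (ν (q i)) (ν t) (ν (rest i)) (ν σ) (φ i) (ν (G i)) ⟩
      ν (rest i) + ν (G i) + ν σ + (ν (q i) + φ i + ν t)
        ≡⟨ cong₂ (λ x y → x + ν σ + (y + ν t)) (ω-rest i i<n) (ω-q i i<n) ⟩
      ψ′ ∎
      where
      open ≡-Reasoning
      lemma : ∀ q t r s φ g → q + t + r + s + (φ + g) ≡ r + g + s + (q + φ + t)
      lemma = solve-∀
      0<qt : 0 < q i * t
      0<qt = *-mono-≤ (0<q i i<n) 0<t
      0<qtσ : 0 < q i * t * σ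
      0<qtσ = *-mono-≤ 0<qt 0<σ
      qtσ∣ : q i * t * σ ∣ Q * t * (Q * t)
      qtσ∣ = *-pres-∣ (*-monoˡ-∣ t (q∣Q i i<n)) (∣m⇒∣m*n t σ∣Q)
      ⊥qtσ : ∀ {c} → Coprime c (Q * t) → Coprime (q i * t * σ) c
      ⊥qtσ c⊥ = coprime-∣ qtσ∣ ∣-refl (Cop.sym (coprime-*ʳ c⊥ c⊥))
      f⊥Qt : Coprime (f i) (Q * t)
      f⊥Qt = coprime-∣ (n∣m*n (G i)) ∣-refl (H⊥Qt i i<n)
      qtσ⊥r : Coprime (q i * t * σ) (rest i)
      qtσ⊥r = ⊥qtσ (except-coprime n λ j j<n _ → H⊥Qt j j<n)
      qtσr⊥f : Coprime (q i * t * σ * rest i) (f i)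
      qtσr⊥f = coprime-*ˡ (⊥qtσ f⊥Qt) (coprime-∣ ∣-refl (n∣m*n (G i)) (rest⊥ i i<n))

    pair′ : ∀ i j → i < j → j < suc n →
            ∃₂ λ d a → N′ i ≡ a * d × N′ j ≡ suc a * d × ν a + φ′ j ≡ ν (suc a) + φ′ i
    -- The difference is `N j`, with `a = q j * t` and `suc a = G j`; the equation is then `ω-q`
    -- with `ν t + ν (G j)` added on both sides.
    pair′ zero (suc j) _ (s≤s j<n) =
      N j , q j * t , trans (cong (_* t) (sym (N*q j j<n))) (lemma (N j) (q j) t) , *-comm (N j) (G j) ,
      trans (cong (_+ φ′ (suc j)) (ω-qt j j<n))
        (trans (lemma′ (ν (q j)) (ν t) (φ j) (ν (G j))) (cong (λ k → ν (G j) + (k + ν t)) (ω-q j j<n)))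
      where
      lemma : ∀ N q t → N * q * t ≡ q * t * N
      lemma = solve-∀
      lemma′ : ∀ q t φ g → q + t + (φ + g) ≡ g + (q + φ + t)
      lemma′ = solve-∀
    -- The old difference `d` persists and `a` becomes `a * G i`, whose successor is `suc a * G j`.
    -- The new factors are coprime to the old quotients because these divide `Q`.
    pair′ (suc i) (suc j) (s≤s i<j) (s≤s j<n) =
      let d , a , Ni≡ , Nj≡ , eq = pair i j i<j j<n
          i<n = <-trans i<j j<n
          cons = consecutive {a = a} {d = d} (0<d {a = a} j<n Nj≡) Ni≡ Nj≡ (Nqt i j i<n j<n)
          a∣Q = ∣-trans (subst (a ∣_) (sym Ni≡) (m∣m*n d)) (N∣Q i i<n)
          1+a∣Q = ∣-trans (subst (suc a ∣_) (sym Nj≡) (m∣m*n d)) (N∣Q j j<n)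
          ω-aG = ω-* (∣⇒0< a∣Q 0<Q) z<s (coprime-∣ a∣Q ∣-refl (Cop.sym (G⊥Q i i<n)))
          ω-1+aG = ω-* z<s z<s (coprime-∣ 1+a∣Q ∣-refl (Cop.sym (G⊥Q j j<n)))
      in
      d , a * G i ,
      trans (cong (_* G i) Ni≡) (lemma a d (G i)) ,
      trans (cong (_* G j) Nj≡) (trans (lemma (suc a) d (G j)) (cong (_* d) (sym cons))) ,
      trans (cong (_+ φ′ (suc j)) ω-aG) (trans (lemma′ (ν a) (ν (G i)) (φ j) (ν (G j)))
        (trans (cong (λ k → k + ν (G i) + ν (G j)) eq)
        (trans (lemma″ (ν (suc a)) (φ i) (ν (G i)) (ν (G j)))
               (cong (_+ φ′ (suc i)) (sym (trans (cong ν cons) ω-1+aG))))))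
      where
      lemma : ∀ a d g → a * d * g ≡ a * g * d
      lemma = solve-∀
      lemma′ : ∀ a g φ h → a + g + (φ + h) ≡ a + φ + g + h
      lemma′ = solve-∀
      lemma″ : ∀ a φ g h → a + φ + g + h ≡ a + h + (φ + g)
      lemma″ = solve-∀

  next : Tuple σ (suc n)
  next = record
    { N = N′ ; q = q′ ; φ = φ′ ; Q = Q′ ; ψ = ψ′
    ; 1<Q = ≤-trans 1<Q (≤-trans (m≤m*n Q t {{>-nonZero 0<t}}) (m≤m*n (Q * t) (P * σ) {{>-nonZero (*-mono-≤ 0<P 0<σ)}}))
    ; σ∣Q = ∣n⇒∣m*n (Q * t) (n∣m*n P)
    ; N*q = N*q′ ; σ∣q = σ∣q′ ; ω-q = ω-q′ ; pair = pair′ }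

-- Size of the tuples

suc-≤-^ : ∀ {a m} → a ≤ 2 ^ m → suc a ≤ 2 ^ suc m
suc-≤-^ {a} {m} a≤ = ≤-trans (+-mono-≤ (>-nonZero⁻¹ (2 ^ m) {{m^n≢0 2 m}}) a≤) (+-monoʳ-≤ (2 ^ m) (m≤m+n (2 ^ m) 0))

n<2^n : ∀ n → n < 2 ^ n
n<2^n zero    = z<s
n<2^n (suc n) = suc-≤-^ {m = n} (n<2^n n)

^-*-≤ : ∀ {a b m n} → a ≤ 2 ^ m → b ≤ 2 ^ n → a * b ≤ 2 ^ (m + n)
^-*-≤ {m = m} {n} a≤ b≤ = ≤-trans (*-mono-≤ a≤ b≤) (≤-reflexive (sym (^-distribˡ-+-* 2 m n)))

^-^-≤ : ∀ {a m n k} → a ≤ 2 ^ m → n ≤ k → a ^ n ≤ 2 ^ (m * k)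
^-^-≤ {a} {m} {n} {k} a≤ n≤k =
  ≤-trans (^-monoˡ-≤ n a≤) (≤-trans (^-monoʳ-≤ (2 ^ m) {{m^n≢0 2 m}} n≤k) (≤-reflexive (^-*-assoc 2 m k)))

n!≤2^[n*n] : ∀ n → n ! ≤ 2 ^ (n * n)
n!≤2^[n*n] zero    = ≤-refl
n!≤2^[n*n] (suc n) = ≤-trans (^-*-≤ {m = n} {n * n} (n<2^n n) (n!≤2^[n*n] n))
  (^-monoʳ-≤ 2 (≤-trans (≤-reflexive (sym (*-suc n n))) (*-mono-≤ (n≤1+n n) ≤-refl)))

-- As `Q * J !` is at least 1, the left side is at most `Q * (suc J) !`, and the bound for
-- factorials applies.
freshPrime-bound : ∀ {Q J L E} → 0 < Q → Q ≤ 2 ^ E → J ≤ L → suc (J * (Q * J !)) ≤ 2 ^ (E + suc L * suc L)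
freshPrime-bound {Q} {J} {L} {E} 0<Q Q≤ J≤L = begin
  suc (J * (Q * J !))             ≤⟨ +-monoˡ-≤ (J * (Q * J !)) (*-mono-≤ 0<Q (1≤n! J)) ⟩
  Q * J ! + J * (Q * J !)         ≡⟨ lemma Q J (J !) ⟩
  Q * (suc J) !                   ≤⟨ ^-*-≤ {m = E} Q≤ (≤-trans (n!≤2^[n*n] (suc J)) (^-monoʳ-≤ 2 (*-mono-≤ (s≤s J≤L) (s≤s J≤L)))) ⟩
  2 ^ (E + suc L * suc L)         ∎
  where
  open ≤-Reasoning
  lemma : ∀ Q J k → Q * k + J * (Q * k) ≡ Q * (k + J * k)
  lemma = solve-∀

module Construction (K S σ : ℕ) (1<σ : 1 < σ) (ω-σ≤S : ν σ ≤ S)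
                    (small : ∀ p → Prime p → p ≤ suc K → p ∣ σ) where

  -- The factor by which one enlargement multiplies the exponent in `Q ≤ 2 ^ E`. In the notation of
  -- `step`, the number `Q * t` costs `E + X`, the product of the `H i` costs `eᴴ * K`, and `σ`
  -- costs `E`.
  growth : ℕ
  growth = 3 + 3 * K + 4 * (S * K) + 2 * (S * K * K)

  step : ∀ {n} → n < K → (T : Tuple σ n) → ∀ E → Tuple.Q T ≤ 2 ^ E → suc (K * S) * suc (K * S) ≤ E →
         Σ (Tuple σ (suc n)) λ T′ → Tuple.Q T′ ≤ 2 ^ (E * growth)
  step {n} n<K T E Q≤ L≤E =
    let t , f , 0<t , t⊥Q , t≤ , spec = shift Q n q (λ _ → ν σ) (ν σ) 1<Q q∣Q
          (λ p pp p≤ i i<n → ∣-trans (small p pp (≤-trans p≤ (s≤s (<⇒≤ n<K)))) (σ∣q i i<n)) (λ _ _ → ≤-refl)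
    in
    Step.next T t f 0<t t⊥Q (λ i i<n → proj₁ (spec i i<n)) (λ i i<n → proj₁ (proj₂ (spec i i<n)))
      (λ i i<n → proj₁ (proj₂ (proj₂ (spec i i<n)))) ,
    bound t f t≤ (λ i i<n → proj₂ (proj₂ (proj₂ (proj₂ (spec i i<n)))))
    where
    open Tuple T
    J = n * ν σ
    F = suc (J * (Q * J !))
    eᶠ X eᴴ : ℕ
    eᶠ = (E + E) * S
    X  = E + eᶠ * K
    eᴴ = E + (E + X) + eᶠ
    -- One `E` is for `Q`; the other absorbs the factorial by `L≤E`.
    F≤ : F ≤ 2 ^ (E + E)
    F≤ = ≤-trans (freshPrime-bound {E = E} 0<Q Q≤ (*-mono-≤ (<⇒≤ n<K) ω-σ≤S)) (^-monoʳ-≤ 2 (+-monoʳ-≤ E L≤E))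
    F^≤ : F ^ ν σ ≤ 2 ^ eᶠ
    F^≤ = ^-^-≤ {m = E + E} F≤ ω-σ≤S
    1≤E : 1 ≤ E
    1≤E = ≤-trans (s≤s z≤n) L≤E
    bound : ∀ t f → t ≤ Q * (F ^ ν σ) ^ n → (∀ i → i < n → f i ≤ F ^ ν σ) →
            Q * t * (∏ n (λ i → suc (q i * t) * f i) * σ) ≤ 2 ^ (E * growth)
    bound t f t≤ f≤ = ≤-trans
      (^-*-≤ {m = E + X} {eᴴ * K + E} (^-*-≤ {m = E} {X} Q≤ t≤X)
        (^-*-≤ {m = eᴴ * K} {E} ∏≤ (≤-trans (∣⇒≤ {{>-nonZero 0<Q}} σ∣Q) Q≤)))
      (≤-reflexive (cong (2 ^_) (lemma E S K)))
      where
      t≤X : t ≤ 2 ^ X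
      t≤X = ≤-trans t≤ (^-*-≤ {m = E} {eᶠ * K} Q≤ (^-^-≤ {m = eᶠ} F^≤ (<⇒≤ n<K)))
      G≤ : ∀ i → i < n → suc (q i * t) ≤ 2 ^ (E + (E + X))
      G≤ i i<n = ≤-trans (suc-≤-^ {m = E + X} (^-*-≤ {m = E} {X} (≤-trans (∣⇒≤ {{>-nonZero 0<Q}} (q∣Q i i<n)) Q≤) t≤X))
                         (^-monoʳ-≤ 2 (+-monoˡ-≤ (E + X) 1≤E))
      ∏≤ : ∏ n (λ i → suc (q i * t) * f i) ≤ 2 ^ (eᴴ * K)
      ∏≤ = ≤-trans (∏-≤-const n (2 ^ eᴴ) λ i i<n → ^-*-≤ {m = E + (E + X)} {eᶠ} (G≤ i i<n) (≤-trans (f≤ i i<n) F^≤))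
                   (^-^-≤ {m = eᴴ} ≤-refl (<⇒≤ n<K))
      lemma : ∀ E S K → let eᶠ = (E + E) * S; X = E + eᶠ * K; eᴴ = E + (E + X) + eᶠ in
              E + X + (eᴴ * K + E) ≡ E * (3 + 3 * K + 4 * (S * K) + 2 * (S * K * K))
      lemma = solve-∀

  tuple : ∀ E → σ ≤ 2 ^ E → suc (K * S) * suc (K * S) ≤ E → ∀ n → n ≤ K →
          Σ (Tuple σ n) λ T → Tuple.Q T ≤ 2 ^ (E * growth ^ n)
  -- The empty tuple starts from `Q = σ`; its sequences are placeholders.
  tuple E σ≤ L≤E zero _ = record
    { N = λ _ → 0 ; q = λ _ → 0 ; φ = λ _ → 0 ; Q = σ ; ψ = 0 ; 1<Q = 1<σ ; σ∣Q = ∣-refl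
    ; N*q = λ _ () ; σ∣q = λ _ () ; ω-q = λ _ () ; pair = λ _ _ _ () } ,
    ≤-trans σ≤ (≤-reflexive (cong (2 ^_) (sym (*-identityʳ E))))
  tuple E σ≤ L≤E (suc n) n<K =
    let T , Q≤ = tuple E σ≤ L≤E n (<⇒≤ n<K)
        T′ , Q′≤ = step n<K T (E * growth ^ n) Q≤ (≤-trans L≤E (m≤m*n E (growth ^ n) {{m^n≢0 growth n}}))
    in T′ , ≤-trans Q′≤ (≤-reflexive (cong (2 ^_) (trans (*-assoc E (growth ^ n) growth) (cong (E *_) (*-comm (growth ^ n) growth)))))

-- Chebyshev's and Mertens' upper bounds

nC0≡1 : ∀ n → n C 0 ≡ 1
nC0≡1 n = refl

nCk≤2^n : ∀ n k → n C k ≤ 2 ^ n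
nCk≤2^n zero    zero    = ≤-refl
nCk≤2^n zero    (suc k) = z≤n
nCk≤2^n (suc n) zero    = ≤-trans (≤-reflexive (nC0≡1 (suc n))) (>-nonZero⁻¹ (2 ^ suc n) {{m^n≢0 2 (suc n)}})
nCk≤2^n (suc n) (suc k) = ≤-trans (≤-reflexive (sym (nCk+nC[k+1]≡[n+1]C[k+1] n k)))
  (+-mono-≤ (nCk≤2^n n k) (≤-trans (nCk≤2^n n (suc k)) (m≤m+n (2 ^ n) 0)))

centralBinomial : ∀ n → ((n + n) C n) * (n ! * n !) ≡ (n + n) !
centralBinomial n = begin
  ((n + n) C n) * (n ! * n !)              ≡⟨ cong (λ k → ((n + n) C n) * (n ! * k !)) (m+n∸n≡m n n) ⟨
  ((n + n) C n) * (n ! * (n + n ∸ n) !)    ≡⟨ cong (_* (n ! * (n + n ∸ n) !)) (nCk≡n!/k![n-k]! (m≤m+n n n)) ⟩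
  (n + n) ! / (n ! * (n + n ∸ n) !) * (n ! * (n + n ∸ n) !)  ≡⟨ m/n*n≡m (k![n∸k]!∣n! (m≤m+n n n)) ⟩
  (n + n) !                              ∎
  where
  open ≡-Reasoning
  instance _ = n !* (n + n ∸ n) !≢0

prime∤! : ∀ {p} n → Prime p → n < p → ¬ p ∣ n !
prime∤! zero    pp n<p p∣ = prime∤1 pp p∣
prime∤! (suc n) pp n<p p∣ with euclidsLemma (suc n) (n !) pp p∣
... | inj₁ p∣1+n = <⇒prime∤ z<s n<p p∣1+n
... | inj₂ p∣n!  = prime∤! n pp (<-trans (n<1+n n) n<p) p∣n!

∣! : ∀ {m n} → 0 < m → m ≤ n → m ∣ n !
∣! {suc m} {n} _ m≤n = ∣-trans (m∣m*n (m !)) (m≤n⇒m!∣n! m≤n)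

prime∣centralBinomial : ∀ {n p} → Prime p → n < p → p ≤ n + n → p ∣ (n + n) C n
prime∣centralBinomial {n} {p} pp n<p p≤2n
  with euclidsLemma ((n + n) C n) (n ! * n !) pp (subst (p ∣_) (sym (centralBinomial n)) (∣! (0<prime pp) p≤2n))
... | inj₁ p∣C = p∣C
... | inj₂ p∣n!n! with euclidsLemma (n !) (n !) pp p∣n!n!
...   | inj₁ p∣n! = contradiction p∣n! (prime∤! n pp n<p)
...   | inj₂ p∣n! = contradiction p∣n! (prime∤! n pp n<p)

2^-cancel-≤ : ∀ {m n} → 2 ^ m ≤ 2 ^ n → m ≤ n
2^-cancel-≤ {m} {n} le = ≮⇒≥ λ n<m → <⇒≱ (^-monoʳ-< 2 (s≤s (s≤s z≤n)) n<m) le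

2*2^ : ∀ n → 2 ^ suc n ≡ 2 ^ n + 2 ^ n
2*2^ n = cong (2 ^ n +_) (+-identityʳ (2 ^ n))

-- For `n = 2 ^ j`, every prime above `n` and up to `2n` divides the central binomial coefficient,
-- which is at most `2 ^ (n + n)`. So `n` raised to the number of these primes is at most
-- `2 ^ (n + n)`, and the exponents of 2 are compared.
chebyshev : ∀ j → j * ∑ (2 ^ j) (λ i → χ (prime? (suc (2 ^ j) + i))) ≤ 2 ^ j + 2 ^ j
chebyshev j = 2^-cancel-≤ (begin
  2 ^ (j * ∑ n (λ i → χ (prime? (suc n + i))))       ≡⟨ ^-*-assoc 2 j _ ⟨
  n ^ ∑ n (λ i → χ (prime? (suc n + i)))             ≡⟨ cong (n ^_) (∑-cong n λ i i<n → χ-cong (prime? (suc n + i)) (prime? (suc n + i) ×-dec ((suc n + i) ∣? c))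
                                                          (λ pp → pp , prime∣centralBinomial pp (m≤m+n (suc n) i) (subst (_≤ n + n) (+-suc n i) (+-monoʳ-≤ n i<n))) proj₁) ⟩
  n ^ ∑ n (λ i → pd (suc n + i) c)                   ≤⟨ ^-monoˡ-≤ (∑ n (λ i → pd (suc n + i) c)) (n≤1+n n) ⟩
  suc n ^ ∑ n (λ i → pd (suc n + i) c)               ≤⟨ ^-prime-divisors≤ (suc n) c 0<c n ⟩
  c                                                  ≤⟨ nCk≤2^n (n + n) n ⟩
  2 ^ (n + n)                                        ∎)
  where
  open ≤-Reasoning
  n = 2 ^ j
  c = (n + n) C n
  0<c : 0 < c
  0<c = ∣⇒0< {c} {(n + n) !} (subst (c ∣_) (centralBinomial n) (m∣m*n (n ! * n !))) (1≤n! (n + n))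

module _ (M : ℕ) (u : ℕ → ℕ) (u≤ : ∀ p → u p * p ≤ M) where

  private
    h : ℕ → ℕ
    h p = χ (prime? p) * u p

    block : ℕ → ℕ
    block j = ∑ (2 ^ j) (λ i → h (suc (2 ^ j) + i))

    block*2^ : ∀ j → block j * 2 ^ j ≤ ∑ (2 ^ j) (λ i → χ (prime? (suc (2 ^ j) + i))) * M
    block*2^ j = begin
      block j * 2 ^ j                                                 ≡⟨ ∑-*ʳ (2 ^ j) (2 ^ j) _ ⟨
      ∑ (2 ^ j) (λ i → h (suc (2 ^ j) + i) * 2 ^ j)                   ≤⟨ ∑-mono (2 ^ j) (λ i _ → le (suc (2 ^ j) + i) (≤-trans (n≤1+n (2 ^ j)) (m≤m+n (suc (2 ^ j)) i))) ⟩
      ∑ (2 ^ j) (λ i → χ (prime? (suc (2 ^ j) + i)) * M)              ≡⟨ ∑-*ʳ (2 ^ j) M _ ⟩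
      ∑ (2 ^ j) (λ i → χ (prime? (suc (2 ^ j) + i))) * M              ∎
      where
      open ≤-Reasoning
      le : ∀ p → 2 ^ j ≤ p → h p * 2 ^ j ≤ χ (prime? p) * M
      le p 2^j≤p = ≤-trans (≤-reflexive (*-assoc (χ (prime? p)) (u p) (2 ^ j)))
        (*-monoʳ-≤ (χ (prime? p)) (≤-trans (*-monoʳ-≤ (u p) 2^j≤p) (u≤ p)))

    -- Each prime of the block contributes at most `M / 2 ^ j`, and by `chebyshev` there are at most
    -- `2 * 2 ^ j / j` of them.
    j*block : ∀ j → j * block j ≤ M + M
    j*block j = *-cancelʳ-≤ (j * block j) (M + M) (2 ^ j) {{m^n≢0 2 j}} (begin
      j * block j * 2 ^ j       ≡⟨ *-assoc j (block j) (2 ^ j) ⟩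
      j * (block j * 2 ^ j)     ≤⟨ *-monoʳ-≤ j (block*2^ j) ⟩
      j * (# * M)               ≡⟨ *-assoc j # M ⟨
      j * # * M                 ≤⟨ *-monoˡ-≤ M (chebyshev j) ⟩
      (2 ^ j + 2 ^ j) * M       ≡⟨ lemma (2 ^ j) M ⟩
      (M + M) * 2 ^ j           ∎)
      where
      open ≤-Reasoning
      # = ∑ (2 ^ j) (λ i → χ (prime? (suc (2 ^ j) + i)))
      lemma : ∀ a b → (a + a) * b ≡ (b + b) * a
      lemma = solve-∀

    -- A second dyadic decomposition, now of the index: the `2 ^ b` blocks with index from `2 ^ b`
    -- up to, but excluding, `2 ^ suc b` contribute at most `2M / 2 ^ b` each, hence `2M` together.
    -- Block 0 consists of the prime 2 alone.
    blocks : ∀ b → ∑ (2 ^ b) block ≤ M + b * (M + M)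
    blocks zero = begin
      block 0                                          ≡⟨ *-identityʳ (block 0) ⟨
      block 0 * 2 ^ 0                                  ≤⟨ block*2^ 0 ⟩
      ∑ (2 ^ 0) (λ i → χ (prime? (2 + i))) * M         ≤⟨ *-monoˡ-≤ M (∑-≤-const 1 1 λ i _ → χ≤1 (prime? (2 + i))) ⟩
      1 * 1 * M                                        ≡⟨ lemma M ⟩
      M + 0                                            ∎
      where
      open ≤-Reasoning
      lemma : ∀ M → 1 * 1 * M ≡ M + 0
      lemma = solve-∀
    blocks (suc b) = begin
      ∑ (2 ^ suc b) block                                      ≡⟨ cong (λ k → ∑ k block) (2*2^ b) ⟩
      ∑ (2 ^ b + 2 ^ b) block                                  ≡⟨ ∑-split (2 ^ b) (2 ^ b) block ⟩
      ∑ (2 ^ b) block + ∑ (2 ^ b) (λ i → block (2 ^ b + i))    ≤⟨ +-mono-≤ (blocks b) last ⟩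
      M + b * (M + M) + (M + M)                                ≡⟨ lemma M (b * (M + M)) (M + M) ⟩
      M + (M + M + b * (M + M))                                ∎
      where
      open ≤-Reasoning
      lemma : ∀ a b c → a + b + c ≡ a + (c + b)
      lemma = solve-∀
      last : ∑ (2 ^ b) (λ i → block (2 ^ b + i)) ≤ M + M
      last = *-cancelˡ-≤ (2 ^ b) {{m^n≢0 2 b}} (begin
        2 ^ b * ∑ (2 ^ b) (λ i → block (2 ^ b + i))      ≡⟨ ∑-*ˡ (2 ^ b) (2 ^ b) _ ⟨
        ∑ (2 ^ b) (λ i → 2 ^ b * block (2 ^ b + i))      ≤⟨ ∑-≤-const (2 ^ b) (M + M) (λ i _ →
                                                              ≤-trans (*-monoˡ-≤ (block (2 ^ b + i)) (m≤m+n (2 ^ b) i)) (j*block (2 ^ b + i))) ⟩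
        2 ^ b * (M + M)                                  ∎)

    dyadic : ∀ J → ∑ (suc (2 ^ J)) h ≡ ∑ J block
    -- The summands at 0 and 1 vanish by computation of `prime?`.
    dyadic zero    = refl
    dyadic (suc J) = trans (cong (λ k → ∑ (suc k) h) (2*2^ J))
      (trans (∑-split (suc (2 ^ J)) (2 ^ J) h) (cong (_+ block J) (dyadic J)))

  -- With `M / p` for `u p`, this says that the sum of 1/p over primes below x is O(log log x), at x
  -- = `2 ^ (2 ^ b)`.
  mertens : ∀ b → ∑ (2 ^ (2 ^ b)) (λ p → χ (prime? p) * u p) ≤ M + b * (M + M)
  mertens b = ≤-trans (∑-monoˡ h (n≤1+n (2 ^ (2 ^ b)))) (≤-trans (≤-reflexive (dyadic (2 ^ b))) (blocks b))

-- The variance of the number of prime divisors of a linear form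

module _ (n : ℕ) .{{_ : NonZero n}} where

  -- The number of `m < M` in a single residue class modulo `n`, namely that of -(1 + s).
  multiples : ℕ → ℕ → ℕ
  multiples s M = ∑ M (λ m → χ (n ∣? suc (m + s)))

  private
    -- The count is the quotient of `M + s` by `n` minus that of `s`; the remainder `r` is carried
    -- along to detect when a multiple of `n` is reached.
    invariant : ∀ s M → ∃ λ r → r < n × M + s ≡ (multiples s M + s / n) * n + r
    invariant s zero    = s % n , m%n<n s n , trans (m≡m%n+[m/n]*n s n) (+-comm (s % n) (s / n * n))
    invariant s (suc M) =
      let r , r<n , eq = invariant s M in step r r<n eq (suc r ≟ n) (n ∣? suc (M + s))
      where
      k = multiples s M
      step : ∀ r → r < n → M + s ≡ (k + s / n) * n + r → Dec (suc r ≡ n) → (d : Dec (n ∣ suc (M + s))) →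
             ∃ λ r′ → r′ < n × suc (M + s) ≡ (k + χ d + s / n) * n + r′
      step r r<n eq _ (yes n∣) = 0 , >-nonZero⁻¹ n , (begin
        suc (M + s)                       ≡⟨ cong suc eq ⟩
        suc ((k + s / n) * n + r)         ≡⟨ +-suc ((k + s / n) * n) r ⟨
        (k + s / n) * n + suc r           ≡⟨ cong ((k + s / n) * n +_) 1+r≡n ⟩
        (k + s / n) * n + n               ≡⟨ lemma k (s / n) n ⟩
        (k + 1 + s / n) * n + 0           ∎)
        where
        open ≡-Reasoning
        lemma : ∀ k x n → (k + x) * n + n ≡ (k + 1 + x) * n + 0
        lemma = solve-∀
        n∣1+r : n ∣ suc r
        n∣1+r = ∣m+n∣m⇒∣n (subst (n ∣_) (trans (cong suc eq) (sym (+-suc ((k + s / n) * n) r))) n∣) (n∣m*n (k + s / n))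
        1+r≡n : suc r ≡ n
        1+r≡n = ≤-antisym r<n (∣⇒≤ n∣1+r)
      step r r<n eq (yes 1+r≡n) (no n∤) = contradiction
        (subst (n ∣_) (sym (trans (cong suc eq) (trans (sym (+-suc ((k + s / n) * n) r)) (cong ((k + s / n) * n +_) 1+r≡n))))
          (∣m∣n⇒∣m+n (n∣m*n (k + s / n)) ∣-refl)) n∤
      step r r<n eq (no 1+r≢n) (no n∤) = suc r , ≤∧≢⇒< r<n 1+r≢n ,
        trans (cong suc eq) (trans (sym (+-suc ((k + s / n) * n) r)) (cong (λ x → (x + s / n) * n + suc r) (sym (+-identityʳ k))))

    balance : ∀ s M → ∃ λ r → r < n × multiples s M * n + r ≡ M + s % n
    balance s M =
      let r , r<n , eq = invariant s M in r , r<n , +-cancelʳ-≡ (s / n * n) _ _ (begin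
        multiples s M * n + r + s / n * n      ≡⟨ lemma (multiples s M) n r (s / n) ⟩
        (multiples s M + s / n) * n + r        ≡⟨ eq ⟨
        M + s                                  ≡⟨ cong (M +_) (m≡m%n+[m/n]*n s n) ⟩
        M + (s % n + s / n * n)                ≡⟨ +-assoc M (s % n) (s / n * n) ⟨
        M + s % n + s / n * n                  ∎)
      where
      open ≡-Reasoning
      lemma : ∀ k n r x → k * n + r + x * n ≡ (k + x) * n + r
      lemma = solve-∀

  multiples*n< : ∀ s M → multiples s M * n < M + n
  multiples*n< s M =
    let r , r<n , eq = balance s M in
    ≤-<-trans (m≤m+n (multiples s M * n) r) (subst (_< M + n) (sym eq) (+-monoʳ-< M (m%n<n s n)))

  <multiples*n : ∀ s M → M < multiples s M * n + n
  <multiples*n s M =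
    let r , r<n , eq = balance s M in
    ≤-<-trans (m≤m+n M (s % n)) (subst (_< multiples s M * n + n) eq (+-monoʳ-< (multiples s M * n) r<n))

  private
    cancel : ∀ a b → a * n < b * n + n + n → a ≤ suc b
    cancel a b lt = s≤s⁻¹ (*-cancelʳ-< n a (2 + b) (subst (a * n <_) (lemma b n) lt))
      where
      lemma : ∀ b n → b * n + n + n ≡ (2 + b) * n
      lemma = solve-∀

  multiples-≤ : ∀ s s′ M → multiples s M ≤ suc (multiples s′ M)
  multiples-≤ s s′ M = cancel (multiples s M) (multiples s′ M)
    (<-trans (multiples*n< s M) (+-monoˡ-< n (<multiples*n s′ M)))

  multiples-≤-/ : ∀ s M → multiples s M ≤ suc (M / n)
  multiples-≤-/ s M = cancel (multiples s M) (M / n)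
    (<-trans (multiples*n< s M) (+-monoˡ-< n (subst (_< M / n * n + n) (sym (m≡m%n+[m/n]*n M n))
      (subst (_< M / n * n + n) (+-comm (M / n * n) (M % n)) (+-monoʳ-< (M / n * n) (m%n<n M n))))))

suc-representative : ∀ x {m} → 0 < m → ∃ λ s → suc s ≡ x [mod m ]
suc-representative x {suc m} _ = x + m , congruent 0 1 (lemma x m)
  where
  lemma : ∀ x m → suc (x + m) + suc m * 0 ≡ x + suc m * 1
  lemma = solve-∀

module _ {p : ℕ} (pp : Prime p) (α β : ℕ) (p∤α : ¬ p ∣ α) where

  -- If `α * suc s` is congruent to `β`, then `α * m + β` is congruent to `α * suc (m + s)` modulo
  -- `p`, and `α` is invertible.
  root-class : ∃ λ s → ∀ m → (p ∣ α * m + β → p ∣ suc (m + s)) × (p ∣ suc (m + s) → p ∣ α * m + β)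
  root-class =
    let a , αa≡1 = mod-inverse (Cop.sym (prime∤⇒coprime pp p∤α))
        s , 1+s≡ = suc-representative (a * β) (0<prime pp)
        equiv : ∀ m → α * suc (m + s) ≡ α * m + β [mod p ]
        equiv m = mod-trans (mod-reflexive (lemma α m s))
          (mod-+ (α * m) (mod-trans (mod-* α 1+s≡) (mod-trans (mod-reflexive (lemma′ α a β))
            (mod-trans (mod-* β αa≡1) (mod-reflexive (*-identityʳ β))))))
    in s , λ m →
      (λ p∣l → case euclidsLemma α (suc (m + s)) pp (∣-resp-mod (mod-sym (equiv m)) p∣l) of λ where
        (inj₁ p∣α) → contradiction p∣α p∤α
        (inj₂ p∣)  → p∣) ,
      (λ p∣ → ∣-resp-mod (equiv m) (∣n⇒∣m*n α p∣))
    where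
    lemma : ∀ α m s → α * suc (m + s) ≡ α * m + α * suc s
    lemma = solve-∀
    lemma′ : ∀ α a β → α * (a * β) ≡ β * (α * a)
    lemma′ = solve-∀

-- The Chinese remainder theorem merges the roots modulo `p` and `q` into one class modulo `p * q`,
-- so that `multiples` counts the joint hits as well.
joint-class : ∀ {p q} → Prime p → Prime q → p ≢ q → ∀ α β α′ β′ → ¬ p ∣ α → ¬ q ∣ α′ →
              ∃ λ s → ∀ m → χ (p ∣? (α * m + β)) * χ (q ∣? (α′ * m + β′)) ≡ χ ((p * q) ∣? suc (m + s))
joint-class {p} {q} pp pq p≢q α β α′ β′ p∤α q∤α′ =
  let s₁ , class₁ = root-class pp α β p∤α
      s₂ , class₂ = root-class pq α′ β′ q∤α′
      x , _ , x≡₁ , x≡₂ = crt₂ (0<prime pp) (0<prime pq) p⊥q (suc s₁) (suc s₂)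
      s , 1+s≡x = suc-representative x (*-mono-≤ (0<prime pp) (0<prime pq))
      shift-class : ∀ m {r t} → suc s ≡ suc t [mod r ] → suc (m + s) ≡ suc (m + t) [mod r ]
      shift-class m {r} {t} s≡t = mod-trans (mod-reflexive (sym (+-suc m s))) (mod-trans (mod-+ m s≡t) (mod-reflexive (+-suc m t)))
      class₁′ : ∀ m → suc (m + s) ≡ suc (m + s₁) [mod p ]
      class₁′ m = shift-class m (mod-trans (mod-∣ (m∣m*n q) 1+s≡x) x≡₁)
      class₂′ : ∀ m → suc (m + s) ≡ suc (m + s₂) [mod q ]
      class₂′ m = shift-class m (mod-trans (mod-∣ (n∣m*n p) 1+s≡x) x≡₂)
  in s , λ m → trans (sym (χ-× (p ∣? (α * m + β)) (q ∣? (α′ * m + β′))))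
    (χ-cong ((p ∣? (α * m + β)) ×-dec (q ∣? (α′ * m + β′))) ((p * q) ∣? suc (m + s))
      (λ (p∣ , q∣) → coprime⇒*∣ p⊥q (∣-resp-mod (mod-sym (class₁′ m)) (proj₁ (class₁ m) p∣))
                                    (∣-resp-mod (mod-sym (class₂′ m)) (proj₁ (class₂ m) q∣)))
      (λ pq∣ → proj₂ (class₁ m) (∣-resp-mod (class₁′ m) (∣-trans (m∣m*n q) pq∣)) ,
               proj₂ (class₂ m) (∣-resp-mod (class₂′ m) (∣-trans (n∣m*n p) pq∣))))
  where
  p⊥q : Coprime p q
  p⊥q = primes-coprime pp pq p≢q

-- M / p, with the junk value 0 at p = 0
quot : ℕ → ℕ → ℕ
quot M zero    = 0
quot M (suc p) = M / suc p

quot*≤ : ∀ M p → quot M p * p ≤ M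
quot*≤ M zero    = z≤n
quot*≤ M (suc p) = m/n*n≤m M (suc p)

∣-∣²-lemma : ∀ a b → ∣ a - b ∣ * ∣ a - b ∣ + 2 * (a * b) ≡ a * a + b * b
∣-∣²-lemma zero    b       = +-identityʳ (b * b)
∣-∣²-lemma (suc a) zero    = cong (λ k → suc a * suc a + 2 * k) (*-zeroʳ a)
∣-∣²-lemma (suc a) (suc b) = begin
  d * d + 2 * (suc a * suc b)                    ≡⟨ lemma (d * d) a b ⟩
  d * d + 2 * (a * b) + 2 * (a + b + 1)          ≡⟨ cong (_+ 2 * (a + b + 1)) (∣-∣²-lemma a b) ⟩
  a * a + b * b + 2 * (a + b + 1)                ≡⟨ lemma′ a b ⟩
  suc a * suc a + suc b * suc b                  ∎
  where
  open ≡-Reasoning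
  d = ∣ a - b ∣
  lemma : ∀ d a b → d + 2 * (suc a * suc b) ≡ d + 2 * (a * b) + 2 * (a + b + 1)
  lemma = solve-∀
  lemma′ : ∀ a b → a * a + b * b + 2 * (a + b + 1) ≡ suc a * suc a + suc b * suc b
  lemma′ = solve-∀

∑-χ≤1 : ∀ n {P : ℕ → Set} (P? : ∀ i → Dec (P i)) → (∀ i j → i < j → j < n → P i → ¬ P j) → ∑ n (λ i → χ (P? i)) ≤ 1
∑-χ≤1 zero    P? unique = z≤n
∑-χ≤1 (suc n) P? unique = go (P? n)
  where
  go : (d : Dec _) → ∑ n (λ i → χ (P? i)) + χ d ≤ 1
  go (yes Pn) = ≤-reflexive (cong (_+ 1) (∑-zero n λ i i<n → χ-no (P? i) λ Pi → unique i n i<n (n<1+n n) Pi Pn))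
  go (no _)   = ≤-trans (≤-reflexive (+-identityʳ _)) (∑-χ≤1 n P? λ i j i<j j<n → unique i j i<j (m<n⇒m<1+n j<n))

module Variance (D M Y : ℕ) where

  -- Leaving out the divisors of `D` ensures, through `good∤α`, that every form has exactly one root
  -- modulo each prime that is counted.
  Good : ℕ → Set
  Good p = Prime p × ¬ p ∣ D

  good? : ∀ p → Dec (Good p)
  good? p = prime? p ×-dec ¬? (p ∣? D)

  record Form : Set where
    field
      α β : ℕ
      good∤α : ∀ {p} → Good p → ¬ p ∣ α

    value : ℕ → ℕ
    value m = α * m + β

    hit : ℕ → ℕ → ℕ
    hit p m = χ (p ∣? value m)

    count : ℕ → ℕ
    count m = ∑ Y (λ p → χ (good? p) * hit p m)

  open Form

  joint : Form → Form → ℕ → ℕ → ℕ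
  joint l l′ p q = ∑ M (λ m → hit l p m * hit l′ q m)

  -- Whichever forms are involved, both sides count one residue class modulo `p * q`, and two such
  -- counts differ by at most one.
  joint-≤ : ∀ {p q} l₁ l₂ l₃ l₄ → Good p → Good q → p ≢ q → joint l₁ l₂ p q ≤ suc (joint l₃ l₄ p q)
  joint-≤ {p} {q} l₁ l₂ l₃ l₄ gp gq p≢q =
    let s , eq   = joint-class (proj₁ gp) (proj₁ gq) p≢q (α l₁) (β l₁) (α l₂) (β l₂) (good∤α l₁ gp) (good∤α l₂ gq)
        s′ , eq′ = joint-class (proj₁ gp) (proj₁ gq) p≢q (α l₃) (β l₃) (α l₄) (β l₄) (good∤α l₃ gp) (good∤α l₄ gq)
    in ≤-trans (≤-reflexive (∑-cong M λ m _ → eq m))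
         (≤-trans (multiples-≤ (p * q) s s′ M) (s≤s (≤-reflexive (∑-cong M λ m _ → sym (eq′ m)))))
    where instance _ = m*n≢0 p q {{prime⇒nonZero (proj₁ gp)}} {{prime⇒nonZero (proj₁ gq)}}

  joint-diagonal : ∀ {p} l → Good p → joint l l p p ≤ suc (quot M p)
  joint-diagonal {zero}  l gp = contradiction (proj₁ gp) ¬prime[0]
  joint-diagonal {suc p} l gp =
    let s , class = root-class (proj₁ gp) (α l) (β l) (good∤α l gp) in
    ≤-trans (≤-reflexive (∑-cong M λ m _ → trans (χ-** (suc p ∣? value l m))
              (χ-cong (suc p ∣? value l m) (suc p ∣? suc (m + s)) (proj₁ (class m)) (proj₂ (class m)))))
            (multiples-≤-/ (suc p) s M)

  weight : ℕ → ℕ → ℕ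
  weight p q = χ (good? p) * χ (good? q)

  ∑-count*count : ∀ l l′ → ∑ M (λ m → count l m * count l′ m) ≡ ∑ Y (λ p → ∑ Y (λ q → weight p q * joint l l′ p q))
  ∑-count*count l l′ = begin
    ∑ M (λ m → count l m * count l′ m)
      ≡⟨ ∑-cong M (λ m _ → ∑-*-∑ Y Y _ _) ⟩
    ∑ M (λ m → ∑ Y (λ p → ∑ Y (λ q → χ (good? p) * hit l p m * (χ (good? q) * hit l′ q m))))
      ≡⟨ ∑-swap M Y _ ⟩
    ∑ Y (λ p → ∑ M (λ m → ∑ Y (λ q → χ (good? p) * hit l p m * (χ (good? q) * hit l′ q m))))
      ≡⟨ ∑-cong Y (λ p _ → ∑-swap M Y _) ⟩
    ∑ Y (λ p → ∑ Y (λ q → ∑ M (λ m → χ (good? p) * hit l p m * (χ (good? q) * hit l′ q m))))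
      ≡⟨ ∑-cong Y (λ p _ → ∑-cong Y λ q _ → trans
           (∑-cong M λ m _ → lemma (χ (good? p)) (hit l p m) (χ (good? q)) (hit l′ q m))
           (∑-*ˡ M (weight p q) _)) ⟩
    ∑ Y (λ p → ∑ Y (λ q → weight p q * joint l l′ p q)) ∎
    where
    open ≡-Reasoning
    lemma : ∀ a b c d → a * b * (c * d) ≡ a * c * (b * d)
    lemma = solve-∀

  diagonal : ℕ → ℕ
  diagonal p = χ (good? p) * (2 * suc (quot M p))

  private
    -- For `p ≢ q` each pure term exceeds the mixed term by at most 1, which accounts for the 2. For
    -- `p ≡ q` the mixed term is discarded and each pure term is at most `suc (quot M p)`. The
    -- decisions are arguments so that matching on them evaluates the indicators.
    termwise : ∀ l l′ p q (dp : Dec (Good p)) (dq : Dec (Good q)) (d≡ : Dec (p ≡ q)) →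
               χ dp * χ dq * joint l l p q + χ dp * χ dq * joint l′ l′ p q ≤
               2 * (χ dp * χ dq * joint l l′ p q) + (2 + χ d≡ * (χ dp * (2 * suc (quot M p))))
    termwise l l′ p q (no _)   dq      d≡ = z≤n
    termwise l l′ p q (yes _)  (no _)  d≡ = z≤n
    termwise l l′ p q (yes gp) (yes gq) (no p≢q) =
      ≤-trans (+-mono-≤ (*-monoʳ-≤ 1 (joint-≤ l l l l′ gp gq p≢q)) (*-monoʳ-≤ 1 (joint-≤ l′ l′ l l′ gp gq p≢q)))
              (≤-reflexive (lemma (joint l l′ p q)))
      where
      lemma : ∀ x → 1 * suc x + 1 * suc x ≡ 2 * (1 * x) + (2 + 0)
      lemma = solve-∀
    termwise l l′ p q (yes gp) (yes gq) (yes refl) =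
      ≤-trans (+-mono-≤ (*-monoʳ-≤ 1 (joint-diagonal l gp)) (*-monoʳ-≤ 1 (joint-diagonal l′ gp)))
        (≤-trans (≤-reflexive (lemma (suc (quot M p)))) (≤-trans (m≤n+m _ 2) (m≤n+m _ (2 * (1 * joint l l′ p p)))))
      where
      lemma : ∀ x → 1 * x + 1 * x ≡ 1 * (1 * (2 * x))
      lemma = solve-∀

  -- The terms with p ≠ q cancel up to an error of 2, since any two residue classes modulo p q
  -- are met equally often up to one.
  variance : ∀ l l′ → ∑ M (λ m → ∣ count l m - count l′ m ∣ * ∣ count l m - count l′ m ∣) ≤ Y * (Y * 2) + ∑ Y diagonal
  variance l l′ = +-cancelʳ-≤ (2 * ∑ M (λ m → count l m * count l′ m)) _ _ (begin
    ∑ M (λ m → ∣ count l m - count l′ m ∣ * ∣ count l m - count l′ m ∣) + 2 * ∑ M (λ m → count l m * count l′ m)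
      ≡⟨ cong (∑ M (λ m → ∣ count l m - count l′ m ∣ * ∣ count l m - count l′ m ∣) +_) (∑-*ˡ M 2 _) ⟨
    ∑ M (λ m → ∣ count l m - count l′ m ∣ * ∣ count l m - count l′ m ∣) + ∑ M (λ m → 2 * (count l m * count l′ m))
      ≡⟨ ∑-+ M _ _ ⟨
    ∑ M (λ m → ∣ count l m - count l′ m ∣ * ∣ count l m - count l′ m ∣ + 2 * (count l m * count l′ m))
      ≡⟨ ∑-cong M (λ m _ → ∣-∣²-lemma (count l m) (count l′ m)) ⟩
    ∑ M (λ m → count l m * count l m + count l′ m * count l′ m)
      ≡⟨ ∑-+ M _ _ ⟩
    ∑ M (λ m → count l m * count l m) + ∑ M (λ m → count l′ m * count l′ m)
      ≡⟨ cong₂ _+_ (∑-count*count l l) (∑-count*count l′ l′) ⟩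
    ∑ Y (λ p → ∑ Y (λ q → weight p q * joint l l p q)) + ∑ Y (λ p → ∑ Y (λ q → weight p q * joint l′ l′ p q))
      ≡⟨ ∑∑-+ _ _ ⟨
    ∑ Y (λ p → ∑ Y (λ q → weight p q * joint l l p q + weight p q * joint l′ l′ p q))
      ≤⟨ ∑-mono Y (λ p _ → ∑-mono Y λ q _ → termwise l l′ p q (good? p) (good? q) (p ≟ q)) ⟩
    ∑ Y (λ p → ∑ Y (λ q → 2 * (weight p q * joint l l′ p q) + (2 + χ (p ≟ q) * diagonal p)))
      ≡⟨ ∑∑-+ _ _ ⟩
    ∑ Y (λ p → ∑ Y (λ q → 2 * (weight p q * joint l l′ p q))) + ∑ Y (λ p → ∑ Y (λ q → 2 + χ (p ≟ q) * diagonal p))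
      ≡⟨ cong₂ _+_ (trans (∑-cong Y λ p _ → ∑-*ˡ Y 2 _) (∑-*ˡ Y 2 _)) (∑∑-+ _ _) ⟩
    2 * ∑ Y (λ p → ∑ Y (λ q → weight p q * joint l l′ p q)) + (∑ Y (λ p → ∑ Y (λ q → 2)) + ∑ Y (λ p → ∑ Y (λ q → χ (p ≟ q) * diagonal p)))
      ≤⟨ +-mono-≤ (≤-reflexive (cong (2 *_) (sym (∑-count*count l l′)))) (+-mono-≤ constants diagonals) ⟩
    2 * ∑ M (λ m → count l m * count l′ m) + (Y * (Y * 2) + ∑ Y diagonal)
      ≡⟨ +-comm (2 * ∑ M (λ m → count l m * count l′ m)) _ ⟩
    Y * (Y * 2) + ∑ Y diagonal + 2 * ∑ M (λ m → count l m * count l′ m) ∎)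
    where
    open ≤-Reasoning
    ∑∑-+ : ∀ (f g : ℕ → ℕ → ℕ) →
           ∑ Y (λ p → ∑ Y (λ q → f p q + g p q)) ≡ ∑ Y (λ p → ∑ Y (f p)) + ∑ Y (λ p → ∑ Y (g p))
    ∑∑-+ f g = trans (∑-cong Y λ p _ → ∑-+ Y (f p) (g p)) (∑-+ Y _ _)
    constants : ∑ Y (λ p → ∑ Y (λ q → 2)) ≤ Y * (Y * 2)
    constants = ∑-≤-const Y (Y * 2) λ _ _ → ≤-reflexive (∑-const Y 2)
    diagonals : ∑ Y (λ p → ∑ Y (λ q → χ (p ≟ q) * diagonal p)) ≤ ∑ Y diagonal
    diagonals = ∑-mono Y λ p _ → ≤-trans (≤-reflexive (∑-*ʳ Y (diagonal p) _))
      (≤-trans (*-monoˡ-≤ (diagonal p) (∑-χ≤1 Y (p ≟_) λ i j i<j _ p≡i p≡j → <⇒≢ i<j (trans (sym p≡i) p≡j))) (≤-reflexive (+-identityʳ (diagonal p))))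

  ∑-diagonal : ∑ Y diagonal ≤ 2 * (∑ Y (λ p → χ (prime? p) * quot M p) + Y)
  ∑-diagonal = begin
    ∑ Y diagonal                                       ≤⟨ ∑-mono Y (λ p _ → le p) ⟩
    ∑ Y (λ p → 2 * (χ (prime? p) * quot M p + 1))      ≡⟨ ∑-*ˡ Y 2 _ ⟩
    2 * ∑ Y (λ p → χ (prime? p) * quot M p + 1)        ≡⟨ cong (2 *_) (trans (∑-+ Y _ _) (cong (∑ Y (λ p → χ (prime? p) * quot M p) +_) (trans (∑-const Y 1) (*-identityʳ Y)))) ⟩
    2 * (∑ Y (λ p → χ (prime? p) * quot M p) + Y)      ∎
    where
    open ≤-Reasoning
    lemma : ∀ c u → c * (2 * suc u) ≡ 2 * (c * u + c)
    lemma = solve-∀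
    le : ∀ p → diagonal p ≤ 2 * (χ (prime? p) * quot M p + 1)
    le p = ≤-trans (*-monoˡ-≤ (2 * suc (quot M p)) (χ-mono (good? p) (prime? p) proj₁))
      (≤-trans (≤-reflexive (lemma (χ (prime? p)) (quot M p))) (*-monoʳ-≤ 2 (+-monoʳ-≤ (χ (prime? p) * quot M p) (χ≤1 (prime? p)))))

-- Coincidences

module _ (K D : ℕ) (e h : ℕ → ℕ) (h≤3 : ∀ i → i < K → h i ≤ 3)
         (distinct : ∀ i j → i < j → j < K → e i + h i ≢ e j + h j) (0<K : 0 < K) where

  private
    x : ℕ → ℕ
    x i = e i + h i

    window : ℕ
    window = (D + 3) + (D + 3)

    -- The window has half-width `D + 3` around `x 0`, where the 3 allows for the `h i`; adding
    -- `D + 3` to `x i` avoids subtraction.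
    inside : ∀ i → i < K → ∣ e i - e 0 ∣ < D → 1 ≤ ∑ window (λ v → χ (x i + (D + 3) ≟ x 0 + v))
    inside i i<K close = ≤-trans (≤-reflexive (sym (χ-yes (x i + (D + 3) ≟ x 0 + v) (sym (m+[n∸m]≡n lower)))))
                                 (term≤∑ (λ v → χ (x i + (D + 3) ≟ x 0 + v)) v<)
      where
      open ≤-Reasoning
      v = x i + (D + 3) ∸ x 0
      lower : x 0 ≤ x i + (D + 3)
      lower = begin
        e 0 + h 0                          ≤⟨ +-mono-≤ (m≤n+∣n-m∣ (e 0) (e i)) (h≤3 0 0<K) ⟩
        e i + ∣ e i - e 0 ∣ + 3            ≤⟨ +-monoˡ-≤ 3 (+-mono-≤ (m≤m+n (e i) (h i)) (<⇒≤ close)) ⟩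
        x i + D + 3                        ≡⟨ +-assoc (x i) D 3 ⟩
        x i + (D + 3)                      ∎
      upper : x i + (D + 3) < x 0 + window
      upper = begin-strict
        e i + h i + (D + 3)                ≤⟨ +-monoˡ-≤ (D + 3) (+-mono-≤ (m≤n+∣m-n∣ (e i) (e 0)) (h≤3 i i<K)) ⟩
        e 0 + ∣ e i - e 0 ∣ + 3 + (D + 3)  <⟨ +-monoˡ-< (D + 3) (+-monoˡ-< 3 (+-monoʳ-< (e 0) close)) ⟩
        e 0 + D + 3 + (D + 3)              ≤⟨ +-monoˡ-≤ (D + 3) (+-monoˡ-≤ 3 (+-monoˡ-≤ D (m≤m+n (e 0) (h 0)))) ⟩
        x 0 + D + 3 + (D + 3)              ≡⟨ trans (cong (_+ (D + 3)) (+-assoc (x 0) D 3)) (+-assoc (x 0) (D + 3) (D + 3)) ⟩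
        x 0 + window                       ∎
      v< : v < window
      v< = +-cancelˡ-< (x 0) v window (subst (_< x 0 + window) (sym (m+[n∸m]≡n lower)) upper)

    -- Each index is paid for either by its large square or, when `e i` is close to `e 0`, by an
    -- entry of the window.
    square : ∀ i → i < K →
             D * D ≤ ∣ e i - e 0 ∣ * ∣ e i - e 0 ∣ + D * D * ∑ window (λ v → χ (x i + (D + 3) ≟ x 0 + v))
    square i i<K with D ≤? ∣ e i - e 0 ∣
    ... | yes far = ≤-trans (*-mono-≤ far far) (m≤m+n _ _)
    ... | no near = ≤-trans (≤-trans (≤-reflexive (sym (*-identityʳ (D * D)))) (*-monoʳ-≤ (D * D) (inside i i<K (≰⇒> near)))) (m≤n+m _ _)

  -- At most 2 D + 6 of the numbers x i lie within D + 3 of x 0.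
  spread : K * (D * D) ≤ ∑ K (λ i → ∣ e i - e 0 ∣ * ∣ e i - e 0 ∣) + D * D * ((D + 3) + (D + 3))
  spread = begin
    K * (D * D)
      ≡⟨ ∑-const K (D * D) ⟨
    ∑ K (λ _ → D * D)
      ≤⟨ ∑-mono K square ⟩
    ∑ K (λ i → ∣ e i - e 0 ∣ * ∣ e i - e 0 ∣ + D * D * ∑ window (λ v → χ (x i + (D + 3) ≟ x 0 + v)))
      ≡⟨ trans (∑-+ K _ _) (cong (∑ K (λ i → ∣ e i - e 0 ∣ * ∣ e i - e 0 ∣) +_) (trans (∑-*ˡ K (D * D) _) (cong (D * D *_) (∑-swap K window _)))) ⟩
    ∑ K (λ i → ∣ e i - e 0 ∣ * ∣ e i - e 0 ∣) + D * D * ∑ window (λ v → ∑ K (λ i → χ (x i + (D + 3) ≟ x 0 + v)))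
      ≤⟨ +-monoʳ-≤ (∑ K (λ i → ∣ e i - e 0 ∣ * ∣ e i - e 0 ∣)) (*-monoʳ-≤ (D * D) (∑-≤-const window 1 λ v _ →
           ∑-χ≤1 K (λ i → x i + (D + 3) ≟ x 0 + v) λ i j i<j j<K xi≡ xj≡ → distinct i j i<j j<K (+-cancelʳ-≡ (D + 3) (x i) (x j) (trans xi≡ (sym xj≡))))) ⟩
    ∑ K (λ i → ∣ e i - e 0 ∣ * ∣ e i - e 0 ∣) + D * D * (window * 1)
      ≡⟨ cong (λ k → ∑ K (λ i → ∣ e i - e 0 ∣ * ∣ e i - e 0 ∣) + D * D * k) (*-identityʳ window) ⟩
    ∑ K (λ i → ∣ e i - e 0 ∣ * ∣ e i - e 0 ∣) + D * D * window ∎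
    where open ≤-Reasoning

-- From equal prime counts of linear forms to consecutive integers

module Endgame {σ K : ℕ} (T : Tuple σ K) (t : ℕ) (f : ℕ → ℕ) (0<t : 0 < t)
               (0<f : ∀ i → i < K → 0 < f i)
               (f∣ : ∀ i → i < K → f i ∣ suc (Tuple.Q T * Tuple.q T i * t))
               (ω-f : ∀ i → i < K → ν (f i) ≡ ν (Tuple.q T i)) (M Y : ℕ) .{{_ : NonZero Y}} where

  open Tuple T

  r : ℕ
  r = ∏ K f

  open Variance (Q * r) M Y

  -- The step `r` of the progression `t + r * m` is divisible by every `f i`, so the divisibility by
  -- `f i` arranged at `t` holds for all `m`.
  L : ℕ → ℕ → ℕ
  L i m = suc (Q * q i * (t + r * m))

  private
    0<N : ∀ i → i < K → 0 < N i
    0<N i i<K = ∣⇒0< (N∣Q i i<K) 0<Q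

    0<d : ∀ {j a d} → j < K → N j ≡ suc a * d → 0 < d
    0<d {j} {a} {d} j<K eq = ∣⇒0< (subst (d ∣_) (sym eq) (n∣m*n (suc a))) (0<N j j<K)

    N*L : ∀ i j m → i < K → j < K → N i * (Q * q i * (t + r * m)) ≡ N j * (Q * q j * (t + r * m))
    N*L i j m i<K j<K = trans (lemma (N i) Q (q i) (t + r * m))
      (trans (cong (λ k → k * (Q * (t + r * m))) (trans (N*q i i<K) (sym (N*q j j<K)))) (sym (lemma (N j) Q (q j) (t + r * m))))
      where
      lemma : ∀ N Q q s → N * (Q * q * s) ≡ N * q * (Q * s)
      lemma = solve-∀

    L⊥L : ∀ i j m → i < j → j < K → Coprime (L i m) (L j m)
    L⊥L i j m i<j j<K =
      let d , a , Ni≡ , Nj≡ , _ = pair i j i<j j<K in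
      consecutive-coprime {a = a} {d = d} (0<d {a = a} j<K Nj≡) Ni≡ Nj≡ (N*L i j m (<-trans i<j j<K) j<K)

    L∤Q : ∀ i m {p} → Prime p → p ∣ L i m → ¬ p ∣ Q
    L∤Q i m pp p∣L p∣Q = prime∤suc pp (∣m⇒∣m*n (t + r * m) (∣m⇒∣m*n (q i) p∣Q)) p∣L

    L-split : ∀ i m → L i m ≡ Q * q i * r * m + suc (Q * q i * t)
    L-split i m = lemma (Q * q i) t r m
      where
      lemma : ∀ c t r m → suc (c * (t + r * m)) ≡ c * r * m + suc (c * t)
      lemma = solve-∀

    f∣L : ∀ i m → i < K → f i ∣ L i m
    f∣L i m i<K = subst (f i ∣_) (sym (L-split i m))
      (∣m∣n⇒∣m+n (∣m⇒∣m*n m (∣n⇒∣m*n (Q * q i) (∣∏ f i<K))) (f∣ i i<K))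

    -- `L i m` is 1 modulo `Q`, and for `j ≢ i` it is coprime to `L j m`, hence to `f j`. So its
    -- only primes dividing `Q * r` are those of `f i`.
    L-good : ∀ i m {p} → i < K → Prime p → p ∣ L i m → ¬ p ∣ f i → Good p
    L-good i m {p} i<K pp p∣L p∤f = pp , λ p∣Qr → case euclidsLemma Q r pp p∣Qr of λ where
        (inj₁ p∣Q) → L∤Q i m pp p∣L p∣Q
        (inj₂ p∣r) → impossible (prime∣∏ K pp p∣r)
      where
      impossible : ¬ (∃ λ j → j < K × p ∣ f j)
      impossible (j , j<K , p∣fj) with <-cmp i j
      ... | tri< i<j _ _  = coprime-prime∤ (L⊥L i j m i<j j<K) pp p∣L (∣-trans p∣fj (f∣L j m j<K))
      ... | tri≈ _ refl _ = p∤f p∣fj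
      ... | tri> _ _ j<i  = coprime-prime∤ (L⊥L j i m j<i i<K) pp (∣-trans p∣fj (f∣L j m j<K)) p∣L

    good∤ : ∀ i → i < K → ∀ {p} → Good p → ¬ p ∣ Q * q i * r
    good∤ i i<K (pp , p∤Qr) p∣ with euclidsLemma (Q * q i) r pp p∣
    ... | inj₂ p∣r = p∤Qr (∣n⇒∣m*n Q p∣r)
    ... | inj₁ p∣Qq with euclidsLemma Q (q i) pp p∣Qq
    ...   | inj₁ p∣Q = p∤Qr (∣m⇒∣m*n r p∣Q)
    ...   | inj₂ p∣q = p∤Qr (∣m⇒∣m*n r (∣-trans p∣q (q∣Q i i<K)))

  -- For i ≥ K a dummy form.
  form : ℕ → Form
  form i with i <? K
  ... | yes i<K = record { α = Q * q i * r ; β = suc (Q * q i * t) ; good∤α = good∤ i i<K }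
  ... | no _    = record { α = 1 ; β = 0 ; good∤α = λ gp → prime∤1 (proj₁ gp) }

  value-form : ∀ i m → i < K → Form.value (form i) m ≡ L i m
  value-form i m i<K with i <? K
  ... | yes _  = sym (L-split i m)
  ... | no i≮K = contradiction i<K i≮K

  -- All relevant primes are below `Y ^ 4`, but only the part `e` below `Y` enters the variance,
  -- whose error term is quadratic in the cutoff.
  e x : ℕ → ℕ → ℕ
  e i m = Form.count (form i) m
  x i m = ∑ (Y ^ 4) (λ p → χ (good? p) * Form.hit (form i) p m)

  h : ℕ → ℕ → ℕ
  h i m = ∑ (Y ^ 4 ∸ Y) (λ k → χ (good? (Y + k)) * Form.hit (form i) (Y + k) m)

  x≡e+h : ∀ i m → x i m ≡ e i m + h i m
  x≡e+h i m = trans (cong (λ k → ∑ k g) (sym (m+[n∸m]≡n Y≤Y⁴))) (∑-split Y (Y ^ 4 ∸ Y) g)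
    where
    g : ℕ → ℕ
    g p = χ (good? p) * Form.hit (form i) p m
    Y≤Y⁴ : Y ≤ Y ^ 4
    Y≤Y⁴ = m≤m*n Y (Y ^ 3) {{m^n≢0 Y 3}}

  private
    χ-good-hit : ∀ i m p → i < K → χ (good? p) * Form.hit (form i) p m ≤ pd p (L i m)
    χ-good-hit i m p i<K rewrite value-form i m i<K =
      ≤-trans (≤-reflexive (sym (χ-× (good? p) (p ∣? L i m))))
        (χ-mono (good? p ×-dec (p ∣? L i m)) (prime? p ×-dec (p ∣? L i m)) λ ((pp , _) , p∣L) → pp , p∣L)

  -- Four distinct prime factors of size at least `Y` would force `L i m` up to `Y ^ 4`.
  h≤3 : ∀ i m → i < K → L i m < Y ^ 4 → h i m ≤ 3
  h≤3 i m i<K L<Y⁴ = s≤s⁻¹ (≰⇒> λ 4≤h → <⇒≱ L<Y⁴ (begin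
    Y ^ 4                                                      ≤⟨ ^-monoʳ-≤ Y 4≤h ⟩
    Y ^ h i m                                                  ≤⟨ ^-monoʳ-≤ Y (∑-mono (Y ^ 4 ∸ Y) λ k _ → χ-good-hit i m (Y + k) i<K) ⟩
    Y ^ ∑ (Y ^ 4 ∸ Y) (λ k → pd (Y + k) (L i m))               ≤⟨ ^-prime-divisors≤ Y (L i m) z<s (Y ^ 4 ∸ Y) ⟩
    L i m                                                      ∎))
    where open ≤-Reasoning

  private
    pd-L : ∀ i m p → i < K → pd p (L i m) ≡ pd p (f i) + χ (good? p) * χ (p ∣? L i m)
    pd-L i m p i<K = go (prime? p) (p ∣? L i m) (p ∣? f i) (good? p)
      where
      go : (dp : Dec (Prime p)) (dL : Dec (p ∣ L i m)) (df : Dec (p ∣ f i)) (dg : Dec (Good p)) →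
           χ (dp ×-dec dL) ≡ χ (dp ×-dec df) + χ dg * χ dL
      go (no ¬pp) dL       df       (yes gp) = contradiction (proj₁ gp) ¬pp
      go (no ¬pp) dL       df       (no _)   = refl
      go (yes pp) (no p∤L) (yes p∣f) dg      = contradiction (∣-trans p∣f (f∣L i m i<K)) p∤L
      go (yes pp) (no p∤L) (no _)   dg       = sym (*-zeroʳ (χ dg))
      go (yes pp) (yes _)  (yes p∣f) (yes gp) = contradiction (∣n⇒∣m*n Q (∣-trans p∣f (∣∏ f i<K))) (proj₂ gp)
      go (yes pp) (yes _)  (yes _)  (no _)   = refl
      go (yes pp) (yes _)  (no _)   (yes _)  = refl
      go (yes pp) (yes p∣L) (no p∤f) (no ¬gp) = contradiction (L-good i m i<K pp p∣L p∤f) ¬gp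

  -- The primes of `f i` contribute `ν (q i)`, which is what compensates the potentials in
  -- `coincidence`; the good primes contribute `x i m`.
  ω-L : ∀ i m → i < K → L i m < Y ^ 4 → ν (L i m) ≡ ν (q i) + x i m
  ω-L i m i<K L<Y⁴ = begin
    ν (L i m)                                                                    ≡⟨ ν-∑ Z z<s L<Y⁴ ⟩
    ∑ Z (λ p → pd p (L i m))                                                     ≡⟨ ∑-cong Z (λ p _ → pd-L i m p i<K) ⟩
    ∑ Z (λ p → pd p (f i) + χ (good? p) * χ (p ∣? L i m))                        ≡⟨ ∑-+ Z _ _ ⟩
    ∑ Z (λ p → pd p (f i)) + ∑ Z (λ p → χ (good? p) * χ (p ∣? L i m))            ≡⟨ cong₂ _+_ (sym (ν-∑ Z (0<f i i<K) (≤-<-trans (∣⇒≤ (f∣L i m i<K)) L<Y⁴)))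
                                                                                      (cong (λ l → ∑ Z (λ p → χ (good? p) * χ (p ∣? l))) (sym (value-form i m i<K))) ⟩
    ν (f i) + x i m                                                              ≡⟨ cong (_+ x i m) (ω-f i i<K) ⟩
    ν (q i) + x i m                                                              ∎
    where
    open ≡-Reasoning
    Z = Y ^ 4

  -- The witness is `a * L i m`, with successor `suc a * L j m`. Together `pair` and `ω-q` give
  -- `ν a + ν (q i) ≡ ν (suc a) + ν (q j)`, so that only `x i m` and `x j m` have to agree.
  coincidence : ∀ i j m → i < j → j < K → L i m < Y ^ 4 → L j m < Y ^ 4 → x i m ≡ x j m →
                ∃ λ n → Q ≤ n × ν n ≡ ν (suc n)
  coincidence i j m i<j j<K Li< Lj< xi≡xj =
    let d , a , Ni≡ , Nj≡ , eq = pair i j i<j j<K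
        i<K = <-trans i<j j<K
        cons = consecutive {a = a} {d = d} (0<d {a = a} j<K Nj≡) Ni≡ Nj≡ (N*L i j m i<K j<K)
        a∣Q = ∣-trans (subst (a ∣_) (sym Ni≡) (m∣m*n d)) (N∣Q i i<K)
        1+a∣Q = ∣-trans (subst (suc a ∣_) (sym Nj≡) (m∣m*n d)) (N∣Q j j<K)
        0<a = ∣⇒0< a∣Q 0<Q
    in
    a * L i m ,
    ≤-trans (Q≤L i i<K) (m≤n*m (L i m) a {{>-nonZero 0<a}}) ,
    (begin
      ν (a * L i m)                        ≡⟨ ω-* 0<a z<s (coprime-∣ a∣Q ∣-refl (Q⊥L i m)) ⟩
      ν a + ν (L i m)                      ≡⟨ cong (ν a +_) (ω-L i m i<K Li<) ⟩
      ν a + (ν (q i) + x i m)              ≡⟨ cong (λ k → ν a + (ν (q i) + k)) xi≡xj ⟩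
      ν a + (ν (q i) + x j m)              ≡⟨ +-assoc (ν a) (ν (q i)) (x j m) ⟨
      ν a + ν (q i) + x j m                ≡⟨ cong (_+ x j m) (balance (ν a) (ν (suc a)) (ν (q i)) (ν (q j)) (φ i) (φ j) eq (trans (ω-q i i<K) (sym (ω-q j j<K)))) ⟩
      ν (suc a) + ν (q j) + x j m          ≡⟨ +-assoc (ν (suc a)) (ν (q j)) (x j m) ⟩
      ν (suc a) + (ν (q j) + x j m)        ≡⟨ cong (ν (suc a) +_) (ω-L j m j<K Lj<) ⟨
      ν (suc a) + ν (L j m)                ≡⟨ ω-* {suc a} z<s z<s (coprime-∣ 1+a∣Q ∣-refl (Q⊥L j m)) ⟨
      ν (suc a * L j m)                    ≡⟨ cong ν cons ⟨
      ν (suc (a * L i m))                  ∎)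
    where
    open ≡-Reasoning
    Q⊥L : ∀ i m → Coprime Q (L i m)
    Q⊥L i m = ¬common-prime⇒coprime 0<Q λ p pp p∣Q p∣L → L∤Q i m pp p∣L p∣Q
    Q≤L : ∀ i → i < K → Q ≤ L i m
    Q≤L i i<K = m≤n⇒m≤1+n (≤-trans (m≤m*n Q (q i) {{>-nonZero (∣⇒0< (q∣Q i i<K) 0<Q)}})
      (m≤m*n (Q * q i) (t + r * m) {{>-nonZero (≤-trans 0<t (m≤m+n t (r * m)))}}))
    balance : ∀ a a′ q q′ φ φ′ → a + φ′ ≡ a′ + φ → q + φ ≡ q′ + φ′ → a + q ≡ a′ + q′
    balance a a′ q q′ φ φ′ eq₁ eq₂ = +-cancelʳ-≡ (φ + φ′) (a + q) (a′ + q′)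
      (trans (lemma a q φ φ′) (trans (cong₂ _+_ eq₁ eq₂) (lemma′ a′ φ q′ φ′)))
      where
      lemma : ∀ a q φ φ′ → a + q + (φ + φ′) ≡ a + φ′ + (q + φ)
      lemma = solve-∀
      lemma′ : ∀ a φ q φ′ → a + φ + (q + φ′) ≡ a + q + (φ + φ′)
      lemma′ = solve-∀

-- Choice of the parameters

+-≤-^ : ∀ {a b m} → a ≤ 2 ^ m → b ≤ 2 ^ m → a + b ≤ 2 ^ suc m
+-≤-^ {m = m} a≤ b≤ = ≤-trans (+-mono-≤ a≤ b≤) (≤-reflexive (sym (2*2^ m)))

^-mono-exponent : ∀ {a m n} → a ≤ 2 ^ m → m ≤ n → a ≤ 2 ^ n
^-mono-exponent a≤ m≤n = ≤-trans a≤ (^-monoʳ-≤ 2 m≤n)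

module _ {σ D b : ℕ} (T : Tuple σ (4 * D)) (t : ℕ) (f : ℕ → ℕ) (0<t : 0 < t)
         (0<f : ∀ i → i < 4 * D → 0 < f i)
         (f∣ : ∀ i → i < 4 * D → f i ∣ suc (Tuple.Q T * Tuple.q T i * t))
         (ω-f : ∀ i → i < 4 * D → ν (f i) ≡ ν (Tuple.q T i)) where

  private
    Y M K V : ℕ
    Y = 2 ^ (2 ^ b)
    -- This many values of `m` make the off-diagonal error `Y * (Y * 2)` just `2 * M`.
    M = Y * Y
    K = 4 * D
    -- Bound for the mean square: 2 from the off-diagonal terms, `2 + 4 * b` from `mertens`, and 2
    -- from the summand `Y ≤ M`.
    V = 6 + 4 * b
    instance
      Y≢0 : NonZero Y
      Y≢0 = m^n≢0 2 (2 ^ b)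
      M≢0 : NonZero M
      M≢0 = m*n≢0 Y Y

  open Endgame T t f 0<t 0<f f∣ ω-f M Y
  open Variance (Tuple.Q T * r) M Y using (variance; ∑-diagonal; diagonal)

  ∑-variance : ∀ i → ∑ M (λ m → ∣ e i m - e 0 m ∣ * ∣ e i m - e 0 m ∣) ≤ M * V
  ∑-variance i = begin
    ∑ M (λ m → ∣ e i m - e 0 m ∣ * ∣ e i m - e 0 m ∣)            ≤⟨ variance (form i) (form 0) ⟩
    Y * (Y * 2) + ∑ Y diagonal                                   ≤⟨ +-monoʳ-≤ (Y * (Y * 2)) ∑-diagonal ⟩
    Y * (Y * 2) + 2 * (∑ Y (λ p → χ (prime? p) * quot M p) + Y)  ≤⟨ +-monoʳ-≤ (Y * (Y * 2)) (*-monoʳ-≤ 2 (+-mono-≤ (mertens M (quot M) (quot*≤ M) b) (m≤m*n Y Y))) ⟩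
    Y * (Y * 2) + 2 * (M + b * (M + M) + M)                      ≡⟨ lemma Y b ⟩
    M * V                                                        ∎
    where
    open ≤-Reasoning
    lemma : ∀ Y b → Y * (Y * 2) + 2 * (Y * Y + b * (Y * Y + Y * Y) + Y * Y) ≡ Y * Y * (6 + 4 * b)
    lemma = solve-∀

  module _ (0<D : 0 < D) (large : 2 * V + 3 * D < D * D) (L< : ∀ i m → i < K → m < M → L i m < Y ^ 4) where

    -- Averaging `spread` over `m < M` gives `K * (D * D) ≤ K * V + D * D * (2 * D + 6)`. With `K =
    -- 4 * D` and after cancelling `2 * D` this becomes `D * D ≤ 2 * V + 3 * D`, against `large`.
    ¬distinct : ¬ (∀ m → m < M → ∀ i j → i < j → j < K → x i m ≢ x j m)
    ¬distinct distinct = <⇒≱ large (*-cancelˡ-≤ (2 * D) {{m*n≢0 2 D {{_}} {{>-nonZero 0<D}}}}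
      (+-cancelʳ-≤ (2 * (D * (D * D))) _ _ (begin
        2 * D * (D * D) + 2 * (D * (D * D))                  ≡⟨ lemma D ⟩
        K * (D * D)                                          ≤⟨ K*D² ⟩
        K * V + D * D * ((D + 3) + (D + 3))                  ≡⟨ lemma′ D V ⟩
        2 * D * (2 * V + 3 * D) + 2 * (D * (D * D))          ∎)))
      where
      open ≤-Reasoning
      lemma : ∀ D → 2 * D * (D * D) + 2 * (D * (D * D)) ≡ 4 * D * (D * D)
      lemma = solve-∀
      lemma′ : ∀ D V → 4 * D * V + D * D * ((D + 3) + (D + 3)) ≡ 2 * D * (2 * V + 3 * D) + 2 * (D * (D * D))
      lemma′ = solve-∀
      lemma″ : ∀ K M V c → K * (M * V) + M * c ≡ M * (K * V + c)
      lemma″ = solve-∀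
      0<K : 0 < K
      0<K = *-mono-≤ {1} {4} (s≤s z≤n) 0<D
      spread-at : ∀ m → m < M → K * (D * D) ≤ ∑ K (λ i → ∣ e i m - e 0 m ∣ * ∣ e i m - e 0 m ∣) + D * D * ((D + 3) + (D + 3))
      spread-at m m<M = spread K D (λ i → e i m) (λ i → h i m) (λ i i<K → h≤3 i m i<K (L< i m i<K m<M))
        (λ i j i<j j<K eq → distinct m m<M i j i<j j<K (trans (x≡e+h i m) (trans eq (sym (x≡e+h j m))))) 0<K
      K*D² : K * (D * D) ≤ K * V + D * D * ((D + 3) + (D + 3))
      K*D² = *-cancelˡ-≤ M (begin
        M * (K * (D * D))
          ≡⟨ ∑-const M (K * (D * D)) ⟨
        ∑ M (λ _ → K * (D * D))
          ≤⟨ ∑-mono M spread-at ⟩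
        ∑ M (λ m → ∑ K (λ i → ∣ e i m - e 0 m ∣ * ∣ e i m - e 0 m ∣) + D * D * ((D + 3) + (D + 3)))
          ≡⟨ trans (∑-+ M _ _) (cong₂ _+_ (∑-swap M K _) (∑-const M _)) ⟩
        ∑ K (λ i → ∑ M (λ m → ∣ e i m - e 0 m ∣ * ∣ e i m - e 0 m ∣)) + M * (D * D * ((D + 3) + (D + 3)))
          ≤⟨ +-monoˡ-≤ _ (∑-≤-const K (M * V) λ i _ → ∑-variance i) ⟩
        K * (M * V) + M * (D * D * ((D + 3) + (D + 3)))
          ≡⟨ lemma″ K M V (D * D * ((D + 3) + (D + 3))) ⟩
        M * (K * V + D * D * ((D + 3) + (D + 3))) ∎)

    -- A bounded search turns the refutation of distinctness into an explicit pair of indices.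
    ∃-coincidence : ∃ λ n → Tuple.Q T ≤ n × ν n ≡ ν (suc n)
    ∃-coincidence = search (anyUpTo? (λ m → anyUpTo? (λ j → anyUpTo? (λ i → x i m ≟ x j m) j) K) M)
      where
      search : Dec (∃ λ m → m < M × ∃ λ j → j < K × ∃ λ i → i < j × x i m ≡ x j m) →
               ∃ λ n → Tuple.Q T ≤ n × ν n ≡ ν (suc n)
      search (yes (m , m<M , j , j<K , i , i<j , eq)) =
        coincidence i j m i<j j<K (L< i m (<-trans i<j j<K) m<M) (L< j m j<K m<M) eq
      search (no none) = contradiction
        (λ m m<M i j i<j j<K eq → none (m , m<M , j , j<K , i , i<j , eq)) ¬distinct

-- Logarithmic bounds for the parameters

module Parameters (D κ ε b : ℕ) (0<D : 0 < D) (K≤ : 4 * D ≤ 2 ^ κ) (ε≡ : ε ≡ 6 * κ + 6 + (4 * κ + 6) * (4 * D))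
                  (b≡ : b ≡ 4 + 3 * κ + 3 * ε) (large : 2 * (6 + 4 * b) + 3 * D < D * D) where

  private
    -- To base 2, `κ` bounds log K, `ε` bounds log log Q, and `b` is log log Y. In `ε`, the part
    -- `6 * κ + 6` is for the initial exponent `E₀` and `4 * κ + 6` for each of the `K` factors
    -- `growth`. `S` bounds `ν σ` because `σ ≤ 2 ^ S`.
    K S σ E₀ E : ℕ
    K = 4 * D
    S = suc K * suc K
    σ = (suc K) !
    E₀ = suc (K * S) * suc (K * S)
    E = 2 ^ ε

    0<K : 0 < K
    0<K = *-mono-≤ {1} {4} (s≤s z≤n) 0<D

    K<σ : K < σ
    K<σ = ≤-trans (≤-reflexive (sym (*-identityʳ (suc K)))) (*-monoʳ-≤ (suc K) (1≤n! K))

    1<σ : 1 < σ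
    1<σ = ≤-<-trans 0<K K<σ

    ω-σ : ν σ ≤ S
    ω-σ = 2^-cancel-≤ (≤-trans (2^ω≤ (<-trans z<s 1<σ)) (n!≤2^[n*n] (suc K)))

    small : ∀ p → Prime p → p ≤ suc K → p ∣ σ
    small p pp p≤ = ∣! (0<prime pp) p≤

    open Construction K S σ 1<σ ω-σ small

    S≤ : S ≤ 2 ^ (suc κ + suc κ)
    S≤ = ^-*-≤ {m = suc κ} {suc κ} (suc-≤-^ {m = κ} K≤) (suc-≤-^ {m = κ} K≤)

    E₀≤ : E₀ ≤ 2 ^ (6 * κ + 6)
    E₀≤ = ≤-trans (^-*-≤ {m = e₁} {e₁} le le) (≤-reflexive (cong (2 ^_) (lemma κ)))
      where
      e₁ = suc (κ + (suc κ + suc κ))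
      le : suc (K * S) ≤ 2 ^ e₁
      le = suc-≤-^ {m = κ + (suc κ + suc κ)} (^-*-≤ {m = κ} {suc κ + suc κ} K≤ S≤)
      lemma : ∀ κ → suc (κ + (suc κ + suc κ)) + suc (κ + (suc κ + suc κ)) ≡ 6 * κ + 6
      lemma = solve-∀

    growth≤ : growth ≤ 2 ^ (4 * κ + 6)
    growth≤ = ≤-trans (+-≤-^ {m = suc (suc B)} (+-≤-^ {m = suc B} (+-≤-^ {m = B} le₁ le₂) le₃)
                (≤-trans le₄ (^-monoʳ-≤ 2 (≤-trans (n≤1+n B) (n≤1+n (suc B))))))
              (≤-reflexive (cong (2 ^_) (lemma κ)))
      where
      B = 4 * κ + 3
      lemma : ∀ κ → suc (suc (suc (4 * κ + 3))) ≡ 4 * κ + 6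
      lemma = solve-∀
      lemma₃ : ∀ κ → 2 + (suc κ + suc κ + κ) ≡ 3 * κ + 4
      lemma₃ = solve-∀
      lemma₄ : ∀ κ → 1 + (suc κ + suc κ + κ + κ) ≡ 4 * κ + 3
      lemma₄ = solve-∀
      κ≤4κ : κ ≤ 4 * κ
      κ≤4κ = m≤n*m κ 4
      3≤2^2 : 3 ≤ 2 ^ 2
      3≤2^2 = s≤s (s≤s (s≤s z≤n))
      le₁ : 3 ≤ 2 ^ B
      le₁ = ^-mono-exponent {m = 2} 3≤2^2 (≤-trans (s≤s (s≤s z≤n)) (m≤n+m 3 (4 * κ)))
      le₂ : 3 * K ≤ 2 ^ B
      le₂ = ^-mono-exponent {m = 2 + κ} (^-*-≤ {m = 2} {κ} 3≤2^2 K≤)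
              (≤-trans (≤-reflexive (+-comm 2 κ)) (+-mono-≤ κ≤4κ (s≤s (s≤s z≤n))))
      le₃ : 4 * (S * K) ≤ 2 ^ suc B
      le₃ = ^-mono-exponent {m = 2 + (suc κ + suc κ + κ)}
              (^-*-≤ {4} {m = 2} {suc κ + suc κ + κ} ≤-refl (^-*-≤ {m = suc κ + suc κ} {κ} S≤ K≤))
              (≤-trans (≤-reflexive (lemma₃ κ)) (≤-trans (+-monoˡ-≤ 4 (*-monoˡ-≤ κ {3} {4} (s≤s (s≤s (s≤s z≤n))))) (≤-reflexive (+-suc (4 * κ) 3))))
      le₄ : 2 * (S * K * K) ≤ 2 ^ B
      le₄ = ^-mono-exponent {m = 1 + (suc κ + suc κ + κ + κ)}
              (^-*-≤ {2} {m = 1} {suc κ + suc κ + κ + κ} ≤-refl (^-*-≤ {m = suc κ + suc κ + κ} {κ} (^-*-≤ {m = suc κ + suc κ} {κ} S≤ K≤) K≤))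
              (≤-reflexive (lemma₄ κ))

    E₀*growth^K≤ : E₀ * growth ^ K ≤ E
    E₀*growth^K≤ = ≤-trans (^-*-≤ {m = 6 * κ + 6} {(4 * κ + 6) * K} E₀≤ (^-^-≤ {m = 4 * κ + 6} growth≤ ≤-refl))
                           (≤-reflexive (cong (2 ^_) (sym ε≡)))

    σ≤ : σ ≤ 2 ^ E₀
    σ≤ = ^-mono-exponent {m = S} (n!≤2^[n*n] (suc K)) (≤-trans (m≤n*m S K {{>-nonZero 0<K}}) (≤-trans (n≤1+n (K * S)) (m≤m*n (suc (K * S)) (suc (K * S)))))

    T : Tuple σ K
    T = proj₁ (tuple E₀ σ≤ ≤-refl K ≤-refl)

    open Tuple T

    Q≤ : Q ≤ 2 ^ E
    Q≤ = ^-mono-exponent {m = E₀ * growth ^ K} (proj₂ (tuple E₀ σ≤ ≤-refl K ≤-refl)) E₀*growth^K≤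

    q≤Q : ∀ i → i < K → q i ≤ Q
    q≤Q i i<K = ∣⇒≤ {{>-nonZero 0<Q}} (q∣Q i i<K)

    ω-q≤E : ∀ i → i < K → ν (q i) ≤ E
    ω-q≤E i i<K = 2^-cancel-≤ (≤-trans (2^ω≤ (∣⇒0< (q∣Q i i<K) 0<Q)) (≤-trans (q≤Q i i<K) Q≤))

    -- Quantities for the second use of `shift`, with `Q * Q` and `Q * q i` in place of `Q` and
    -- `q i`, and with `E` bounding `ν (q i)`. `B` adds the exponents of `Q * q i` and of a common
    -- bound for `t` and `r`.
    J F eᶠ X B : ℕ
    J = K * E
    F = suc (J * (Q * Q * J !))
    eᶠ = E + E + suc J * suc J
    X = eᶠ * E * K
    B = E + E + (E + E + X)

    Q*Q≤ : Q * Q ≤ 2 ^ (E + E)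
    Q*Q≤ = ^-*-≤ {m = E} {E} Q≤ Q≤

    [F^E]^K≤ : (F ^ E) ^ K ≤ 2 ^ X
    [F^E]^K≤ = ^-^-≤ {m = eᶠ * E} (^-^-≤ {m = eᶠ} (freshPrime-bound {J = J} {E = E + E} (*-mono-≤ 0<Q 0<Q) Q*Q≤ ≤-refl) ≤-refl) ≤-refl

    B<2^b : suc B ≤ 2 ^ b
    B<2^b = ≤-trans (≤-reflexive (lemma E X)) (≤-trans (+-≤-^ {m = 3 + 3 * κ + 3 * ε} left right) (≤-reflexive (cong (2 ^_) (sym b≡))))
      where
      lemma : ∀ E X → suc (E + E + (E + E + X)) ≡ suc (4 * E) + X
      lemma = solve-∀
      ε≤3ε : ε ≤ 3 * ε
      ε≤3ε = m≤n*m ε 3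
      left : suc (4 * E) ≤ 2 ^ (3 + 3 * κ + 3 * ε)
      left = ^-mono-exponent {m = suc (2 + ε)} (suc-≤-^ {m = 2 + ε} (^-*-≤ {4} {m = 2} {ε} ≤-refl ≤-refl))
               (+-mono-≤ (m≤m+n 3 (3 * κ)) ε≤3ε)
      J≤ : J ≤ 2 ^ (κ + ε)
      J≤ = ^-*-≤ {m = κ} {ε} K≤ ≤-refl
      eᶠ≤ : eᶠ ≤ 2 ^ suc (suc (κ + ε) + suc (κ + ε))
      eᶠ≤ = +-≤-^ {m = suc (κ + ε) + suc (κ + ε)}
        (^-mono-exponent {m = suc ε} (+-≤-^ {m = ε} ≤-refl ≤-refl) (≤-trans (s≤s (m≤n+m ε κ)) (m≤m+n (suc (κ + ε)) _)))
        (^-*-≤ {m = suc (κ + ε)} {suc (κ + ε)} (suc-≤-^ {m = κ + ε} J≤) (suc-≤-^ {m = κ + ε} J≤))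
      right : X ≤ 2 ^ (3 + 3 * κ + 3 * ε)
      right = ≤-trans (^-*-≤ {m = suc (suc (κ + ε) + suc (κ + ε)) + ε} {κ}
                        (^-*-≤ {m = suc (suc (κ + ε) + suc (κ + ε))} {ε} eᶠ≤ ≤-refl) K≤)
                      (≤-reflexive (cong (2 ^_) (lemma′ κ ε)))
        where
        lemma′ : ∀ κ ε → suc (suc (κ + ε) + suc (κ + ε)) + ε + κ ≡ 3 + 3 * κ + 3 * ε
        lemma′ = solve-∀

    Y : ℕ
    Y = 2 ^ (2 ^ b)

    1<Y : 1 < Y
    1<Y = ≤-trans (s≤s (>-nonZero⁻¹ (2 ^ b) {{m^n≢0 2 b}})) (n<2^n (2 ^ b))

    -- The value is at most `suc (2 ^ B) * (Y * Y)`, and `suc B ≤ 2 ^ b` makes the first factor at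
    -- most `Y`.
    L-bound : ∀ {t r} → t ≤ Q * Q * (F ^ E) ^ K → r ≤ (F ^ E) ^ K →
              ∀ i m → i < K → m < Y * Y → suc (Q * q i * (t + r * m)) < Y ^ 4
    L-bound {t} {r} t≤ r≤ i m i<K m< = begin-strict
      suc (Q * q i * (t + r * m))                        ≤⟨ s≤s (*-mono-≤ {Q * q i} {2 ^ (E + E)} (≤-trans (*-monoʳ-≤ Q (q≤Q i i<K)) Q*Q≤)
                                                             (+-mono-≤ t≤2^ (*-monoˡ-≤ m r≤2^))) ⟩
      suc (2 ^ (E + E) * (2ᶜ + 2ᶜ * m))                    ≡⟨ cong (λ k → suc (2 ^ (E + E) * k)) (*-suc 2ᶜ m) ⟨
      suc (2 ^ (E + E) * (2ᶜ * suc m))                    ≤⟨ s≤s (*-monoʳ-≤ (2 ^ (E + E)) (*-monoʳ-≤ 2ᶜ m<)) ⟩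
      suc (2 ^ (E + E) * (2ᶜ * (Y * Y)))                  ≡⟨ cong suc (trans (sym (*-assoc (2 ^ (E + E)) 2ᶜ (Y * Y))) (cong (_* (Y * Y)) (sym (^-distribˡ-+-* 2 (E + E) (E + E + X))))) ⟩
      suc (2 ^ B * (Y * Y))                              ≤⟨ +-monoˡ-≤ (2 ^ B * (Y * Y)) (*-mono-≤ 0<Y 0<Y) ⟩
      suc (2 ^ B) * (Y * Y)                              ≤⟨ *-monoˡ-≤ (Y * Y) (≤-trans (suc-≤-^ {m = B} ≤-refl) (^-monoʳ-≤ 2 B<2^b)) ⟩
      Y * (Y * Y)                                        <⟨ *-monoʳ-< Y {{>-nonZero 0<Y}} (m<m*n (Y * Y) Y {{m*n≢0 Y Y {{>-nonZero 0<Y}} {{>-nonZero 0<Y}}}} 1<Y) ⟩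
      Y * (Y * Y * Y)                                    ≡⟨ lemma Y ⟩
      Y ^ 4                                              ∎
      where
      open ≤-Reasoning
      2ᶜ = 2 ^ (E + E + X)
      0<Y : 0 < Y
      0<Y = <-trans z<s 1<Y
      t≤2^ : t ≤ 2ᶜ
      t≤2^ = ≤-trans t≤ (^-*-≤ {m = E + E} {X} Q*Q≤ [F^E]^K≤)
      r≤2^ : r ≤ 2ᶜ
      r≤2^ = ^-mono-exponent {m = X} (≤-trans r≤ [F^E]^K≤) (m≤n+m X (E + E))
      lemma : ∀ Y → Y * (Y * Y * Y) ≡ Y * (Y * (Y * (Y * 1)))
      lemma = solve-∀

  -- Unboundedness comes from `K < σ ≤ Q ≤ n`.
  solution : ∃ λ n → K < n × ν n ≡ ν (suc n)
  solution =
    let t , f , 0<t , _ , t≤ , spec = shift (Q * Q) K (λ i → Q * q i) (λ i → ν (q i)) E (*-mono-≤ 1<Q 0<Q)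
          (λ i i<K → *-monoʳ-∣ Q (q∣Q i i<K))
          (λ p pp p≤ i i<K → ∣n⇒∣m*n Q (∣-trans (small p pp p≤) (σ∣q i i<K))) ω-q≤E
        n , Q≤n , eq = ∃-coincidence {b = b} T t f 0<t
          (λ i i<K → proj₁ (proj₂ (proj₂ (proj₂ (spec i i<K)))))
          (λ i i<K → proj₁ (proj₂ (spec i i<K)))
          (λ i i<K → proj₁ (proj₂ (proj₂ (spec i i<K)))) 0<D large
          (L-bound t≤ (∏-≤-const K (F ^ E) λ i i<K → proj₂ (proj₂ (proj₂ (proj₂ (spec i i<K))))))
    in n , <-≤-trans K<σ (≤-trans (∣⇒≤ {{>-nonZero 0<Q}} σ∣Q) Q≤n) , eq

-- The final numerical inequality

552[N+15]+1871< : ∀ N → 552 * (N + 15) + 1871 < 2 ^ (N + 15)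
552[N+15]+1871< zero    = <ᵇ⇒< (552 * 15 + 1871) (2 ^ 15) _
552[N+15]+1871< (suc N) = begin-strict
  552 * suc (N + 15) + 1871              ≡⟨ lemma (N + 15) ⟩
  552 * (N + 15) + 1871 + 552            <⟨ +-mono-<-≤ ih (≤-trans (m≤n+m 552 1319) (≤-trans (m≤n+m 1871 (552 * (N + 15))) (≤-trans (<⇒≤ ih) (m≤m+n (2 ^ (N + 15)) 0)))) ⟩
  2 ^ suc (N + 15)                       ∎
  where
  open ≤-Reasoning
  ih = 552[N+15]+1871< N
  lemma : ∀ k → 552 * suc k + 1871 ≡ 552 * k + 1871 + 552
  lemma = solve-∀

-- `b` is linear in `D` with coefficients linear in `δ`. By `1 ≤ D` the terms free of `D` are merged
-- into the others: 168 + 384 = 552 and 524 + 1347 = 1871.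
large-enough : ∀ D δ → 552 * δ + 1871 < D →
               let κ = 2 + δ; ε = 6 * κ + 6 + (4 * κ + 6) * (4 * D); b = 4 + 3 * κ + 3 * ε in
               2 * (6 + 4 * b) + 3 * D < D * D
large-enough D δ lt = begin-strict
  2 * (6 + 4 * b) + 3 * D                    ≡⟨ lemma D δ ⟩
  (168 * δ + 524) * 1 + (384 * δ + 1347) * D ≤⟨ +-monoˡ-≤ ((384 * δ + 1347) * D) (*-monoʳ-≤ (168 * δ + 524) 0<D) ⟩
  (168 * δ + 524) * D + (384 * δ + 1347) * D ≡⟨ lemma′ D δ ⟩
  (552 * δ + 1871) * D                       <⟨ *-monoˡ-< D {{>-nonZero 0<D}} lt ⟩
  D * D                                      ∎
  where
  open ≤-Reasoning
  κ = 2 + δ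
  ε = 6 * κ + 6 + (4 * κ + 6) * (4 * D)
  b = 4 + 3 * κ + 3 * ε
  0<D : 0 < D
  0<D = ≤-<-trans z≤n lt
  lemma : ∀ D δ → let κ = 2 + δ; ε = 6 * κ + 6 + (4 * κ + 6) * (4 * D); b = 4 + 3 * κ + 3 * ε in
          2 * (6 + 4 * b) + 3 * D ≡ (168 * δ + 524) * 1 + (384 * δ + 1347) * D
  lemma = solve-∀
  lemma′ : ∀ D δ → (168 * δ + 524) * D + (384 * δ + 1347) * D ≡ (552 * δ + 1871) * D
  lemma′ = solve-∀

theorem1 : ∀ (N : ℕ) → ∃[ n ] (N ≤ n × 1 ≤ n × ω n ≡ ω (suc n))
theorem1 N =
  let n , K<n , eq = Parameters.solution D (2 + δ) _ _ 0<D (≤-reflexive (lemma D)) refl refl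
                       (large-enough D δ (552[N+15]+1871< N))
      D<n = ≤-<-trans (m≤n*m D 4) K<n
  in n , ≤-trans (m≤m+n N 15) (<⇒≤ (<-trans (n<2^n δ) D<n)) , <-trans 0<D D<n ,
     trans (sym (ν≡ω n)) (trans eq (ν≡ω (suc n)))
  where
  δ D : ℕ
  -- From 15 on the exponential dominates. As `D` is a power of two, `4 * D` is exactly
  -- `2 ^ (2 + δ)`, whence `2 + δ` for `κ`.
  δ = N + 15
  D = 2 ^ δ
  0<D : 0 < D
  0<D = >-nonZero⁻¹ D {{m^n≢0 2 δ}}
  lemma : ∀ D → 4 * D ≡ 2 * (2 * D)
  lemma = solve-∀
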